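{- As formal power series in $q$, \[ \frac{(-q;q^2)_\infty}{(q;q^2)_\infty} = \sum_{n\geq k\geq 0}q^{2k+(n-k)^2}\,Y_{q^4}(n,k)\,(q^2;q^2)_{n+k}^{ -1}\,[2(n-k)+2]_q . \]
   Context: $(a;q)_k=\prod_{j=0}^{k-1}(1-aq^j)$, $(a;q)_0=1$, $(a;q)_\infty=\prod_{j\ge0}(1-aq^j)$ (and likewise with base $q^2$). For $m\ge 0$: $[m]_q=1+q+\cdots+q^{m-1}$, $[m]_q!=[m]_q[m-1]_q\cdots[1]_q$, and for $m\ge j\ge 0$, $\begin{bmatrix} m\\ j\end{bmatrix}_q=\frac{[m]_q!}{[j]_q![m-j]_q!}$. For $m\ge j\ge 0$ the $q$-Yamanouchi number is $Y_q(m,j)=\frac{[m-j+1]_q}{[m+1]_q}\begin{bmatrix} m+j\\ m\end{bmatrix}_q$; $Y_{q^4}$ denotes this with $q$ replaced by $q^4$. -}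

module Defs where

open import Data.Nat using (ℕ; zero; suc; _∸_; _≡ᵇ_) renaming (_+_ to _+ℕ_; _*_ to _*ℕ_)
open import Data.Integer using (ℤ; 0ℤ; 1ℤ; -1ℤ; _+_; _*_; _-_; -_)
open import Data.Bool using (if_then_else_)
open import Relation.Binary.PropositionalEquality using (_≡_)

-- Formal power series in q with integer coefficients: n ↦ coefficient of q^n.
PS : Set
PS = ℕ → ℤ

infix 4 _≈ₚ_
_≈ₚ_ : PS → PS → Set
f ≈ₚ g = ∀ n → f n ≡ g n

sumℤ : ℕ → (ℕ → ℤ) → ℤ
sumℤ zero    a = 0ℤ
sumℤ (suc n) a = sumℤ n a + a n

mono : ℕ → PS
mono k n = if k ≡ᵇ n then 1ℤ else 0ℤ

oneₚ : PS
oneₚ = mono 0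

scale : ℤ → PS → PS
scale c f n = c * f n

infixl 6 _+ₚ_ _-ₚ_
infixl 7 _*ₚ_

_+ₚ_ : PS → PS → PS
(f +ₚ g) n = f n + g n

_-ₚ_ : PS → PS → PS
(f -ₚ g) n = f n - g n

_*ₚ_ : PS → PS → PS
(f *ₚ g) n = sumℤ (suc n) (λ i → f i * g (n ∸ i))

powₚ : PS → ℕ → PS
powₚ f zero    = oneₚ
powₚ f (suc k) = powₚ f k *ₚ f

sumₚ : ℕ → (ℕ → PS) → PS
sumₚ n F m = sumℤ n (λ i → F i m)

prodₚ : ℕ → (ℕ → PS) → PS
prodₚ zero    F = oneₚ
prodₚ (suc n) F = prodₚ n F *ₚ F n

-- Multiplicative inverse of a power series f with constant term 1:
-- f⁻¹ = Σ_{k≥0} (1 - f)^k ; since (1 - f) has zero constant term,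
-- only k ≤ n contribute to the coefficient of q^n.
invₚ : PS → PS
invₚ f n = sumℤ (suc n) (λ k → powₚ (oneₚ -ₚ f) k n)

pochFactor : ℤ → ℕ → ℕ → ℕ → PS
pochFactor c e d j = oneₚ -ₚ scale c (mono (e +ℕ d *ℕ j))

poch : ℤ → ℕ → ℕ → ℕ → PS
poch c e d k = prodₚ k (pochFactor c e d)

-- (c q^e ; q^d)_∞ for e ≥ 1, d ≥ 1: the j-th factor is ≡ 1 mod q^(j+1),
-- so the coefficient of q^N of the infinite product equals that of
-- the partial product over j ≤ N.
pochInf : ℤ → ℕ → ℕ → PS
pochInf c e d N = poch c e d (suc N) N

qint : ℕ → ℕ → PS
qint d m = sumₚ m (λ i → mono (d *ℕ i))

qfact : ℕ → ℕ → PS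
qfact d m = prodₚ m (λ i → qint d (suc i))

-- q-binomial [m choose j]_{q^d} = [m]! / ([j]! [m-j]!)   (m ≥ j)
qbinom : ℕ → ℕ → ℕ → PS
qbinom d m j = qfact d m *ₚ invₚ (qfact d j *ₚ qfact d (m ∸ j))

-- q-Yamanouchi number Y_{q^d}(m,j) = [m-j+1]/[m+1] * [m+j choose m]  (m ≥ j)
qYam : ℕ → ℕ → ℕ → PS
qYam d m j = qint d (suc (m ∸ j)) *ₚ invₚ (qint d (suc m)) *ₚ qbinom d (m +ℕ j) m

lhs : PS
lhs = pochInf -1ℤ 1 2 *ₚ invₚ (pochInf 1ℤ 1 2)

-- Summand for n = k + j (so n ≥ k ≥ 0, j = n - k):
-- q^{2k+(n-k)^2} Y_{q^4}(n,k) (q^2;q^2)_{n+k}^{-1} [2(n-k)+2]_q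
summand : ℕ → ℕ → PS
summand k j =
  mono (2 *ℕ k +ℕ j *ℕ j) *ₚ qYam 4 (k +ℕ j) k
    *ₚ invₚ (poch 1ℤ 2 2 (k +ℕ (k +ℕ j))) *ₚ qint 1 (2 *ℕ j +ℕ 2)

-- Right-hand side: Σ_{n ≥ k ≥ 0} summand.  Summand (k,j) is O(q^{2k+j^2}),
-- so for the coefficient of q^N only k ≤ N, j ≤ N can contribute;
-- the remaining (finitely many extra) terms in the range contribute 0.
rhs : PS
rhs N = sumℤ (suc N) (λ k → sumℤ (suc N) (λ j → summand k j N))

{-# OPTIONS --safe #-}

-- Put x = q², p = q⁴, u a = 1/(p;p)_a, w M = 1/(x;x)_M and group the summands by M = n + k.
-- The sum G M = Σ_{a+b=M} x^(b-a choose 2) u a u b satisfies (1 - x^M) G M = G (M-1): absorb 1 - x^2a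
-- into u a and use the symmetry a ↔ b. Hence G M = w M. Since
-- x^(d-1 choose 2) (1 - x^d) (1 - x^2d) is even in d and vanishes at d = 0, the group M is half of a
-- full sum over a + b = M + 1, d = b - a, which reduces to G M and G (M+1); the group turns out to be
-- (1 + q) q^M A M with A M = (p;p)_M w(M)² = (-x;x)_M / (x;x)_M.
-- Finally Φ(z) = Σ_M A M z^M satisfies (1 - z) Φ(z) = (1 + x z) Φ(x z), the q-binomial theorem,
-- and iterating this from z = q gives the product side modulo any power of q.

module Submission where

open import Defs
open import Algebra.Bundles using (CommutativeRing; RawRing)
import Algebra.Properties.CommutativeSemigroup as CommutativeSemigroupProperties
import Algebra.Solver.Ring as RingSolver
open import Algebra.Solver.Ring.AlmostCommutativeRing
  using (fromCommutativeRing; _-Raw-AlmostCommutative⟶_)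
open import Data.Integer using (ℤ; 0ℤ; 1ℤ; -1ℤ; _+_; _*_; _-_; -_)
import Data.Integer.Properties as ℤₚ
open import Data.Maybe using (Maybe; just; nothing)
open import Data.Nat as ℕ using (ℕ; zero; suc; _∸_; _≤_; _<_; z≤n; s≤s)
  renaming (_+_ to _+ℕ_; _*_ to _*ℕ_)
import Data.Nat.Properties as ℕₚ
open import Data.Nat.Solver using (module +-*-Solver)
open import Data.Product using (_,_)
open import Data.Sum using (inj₁; inj₂)
open import Level using (0ℓ)
open import Relation.Binary.Bundles using (Setoid)
open import Relation.Binary.PropositionalEquality
  using (_≡_; refl; sym; trans; cong; cong₂; module ≡-Reasoning)
import Relation.Binary.Reasoning.Setoid as SetoidReasoning
open import Relation.Nullary using (yes; no)

-- The summands dictate the even function of d. In brackets with base p, the q-Yamanouchi number is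
-- [n-k+1] [n+k]! / ([n+1]! [k]!); up to a factor depending only on M it is (1 - p^(n-k+1)) u k u
-- (n+1). This suggests a = k and b = n + 1, so that a + b = M + 1 and d = n - k + 1 runs over the
-- positive values. The power of q splits as q^M x^(d-1 choose 2), and multiplying [2d]_q by 1 - x
-- leaves (1 + q) (1 - x^d). Two obstacles shape the argument. Folding a symmetric sum determines
-- only the double of a group, and a general commutative ring offers no division by 2; the algebra
-- therefore carries doubled identities, and the 2 is cancelled in the integer coefficients.
-- Moreover Φ is an infinite series; it is replaced by finite truncations with an explicit boundary
-- term, so that the limit becomes a congruence modulo q^(N+1).

module FiniteSums {c ℓ} (R : CommutativeRing c ℓ) where

  open CommutativeRing R
    renaming (Carrier to C; _+_ to _⊕_; _*_ to _⊗_; refl to ≈-refl; sym to ≈-sym; trans to ≈-trans)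
  open SetoidReasoning setoid
  open CommutativeSemigroupProperties (CommutativeRing.+-commutativeSemigroup R) using (interchange)

  -- Finite sums over a + b = n and over 2k + j = n

  ∑ : ℕ → (ℕ → C) → C
  ∑ zero    f = 0#
  ∑ (suc n) f = ∑ n f ⊕ f n

  ∑-distribˡ : ∀ a n f → a ⊗ ∑ n f ≈ ∑ n (λ i → a ⊗ f i)
  ∑-distribˡ a zero    f = zeroʳ a
  ∑-distribˡ a (suc n) f = ≈-trans (distribˡ a _ _) (+-congʳ (∑-distribˡ a n f))

  -- conv n h = Σ_{a+b=n} h a b
  conv : ℕ → (ℕ → ℕ → C) → C
  conv zero    h = h 0 0
  conv (suc n) h = h 0 (suc n) ⊕ conv n (λ a b → h (suc a) b)

  conv-cong : ∀ n {f g} → (∀ a b → a +ℕ b ≡ n → f a b ≈ g a b) → conv n f ≈ conv n g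
  conv-cong zero    f≈g = f≈g 0 0 refl
  conv-cong (suc n) f≈g =
    +-cong (f≈g 0 (suc n) refl) (conv-cong n (λ a b e → f≈g (suc a) b (cong suc e)))

  conv-+ : ∀ n f g → conv n f ⊕ conv n g ≈ conv n (λ a b → f a b ⊕ g a b)
  conv-+ zero    f g = ≈-refl
  conv-+ (suc n) f g = ≈-trans (interchange _ _ _ _) (+-congˡ (conv-+ n _ _))

  conv-distribˡ : ∀ r n f → r ⊗ conv n f ≈ conv n (λ a b → r ⊗ f a b)
  conv-distribˡ r zero    f = ≈-refl
  conv-distribˡ r (suc n) f = ≈-trans (distribˡ r _ _) (+-congˡ (conv-distribˡ r n _))

  conv-last : ∀ n h → conv (suc n) h ≈ conv n (λ a b → h a (suc b)) ⊕ h (suc n) 0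
  conv-last zero    h = ≈-refl
  conv-last (suc n) h = ≈-trans (+-congˡ (conv-last n (λ a b → h (suc a) b))) (≈-sym (+-assoc _ _ _))

  conv-flip : ∀ n h → conv n h ≈ conv n (λ a b → h b a)
  conv-flip zero    h = ≈-refl
  conv-flip (suc n) h = begin
    h 0 (suc n) ⊕ conv n (λ a b → h (suc a) b)  ≈⟨ +-comm _ _ ⟩
    conv n (λ a b → h (suc a) b) ⊕ h 0 (suc n)  ≈⟨ +-congʳ (conv-flip n _) ⟩
    conv n (λ a b → h (suc b) a) ⊕ h 0 (suc n)  ≈⟨ conv-last n (λ a b → h b a) ⟨
    conv (suc n) (λ a b → h b a)                ∎

  -- halfConv n f = Σ_{2k+j=n} f k j
  halfConv : ℕ → (ℕ → ℕ → C) → C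
  halfConv zero          f = f 0 0
  halfConv (suc zero)    f = f 0 1
  halfConv (suc (suc n)) f = f 0 (suc (suc n)) ⊕ halfConv n (λ k j → f (suc k) j)

  halfConv-cong : ∀ n {f g} → (∀ k j → k +ℕ (k +ℕ j) ≡ n → f k j ≈ g k j) → halfConv n f ≈ halfConv n g
  halfConv-cong zero          f≈g = f≈g 0 0 refl
  halfConv-cong (suc zero)    f≈g = f≈g 0 1 refl
  halfConv-cong (suc (suc n)) f≈g = +-cong (f≈g 0 (suc (suc n)) refl)
    (halfConv-cong n (λ k j e →
      f≈g (suc k) j (cong suc (trans (ℕₚ.+-suc k (k +ℕ j)) (cong suc e)))))

  halfConv-distribˡ : ∀ r n f → r ⊗ halfConv n f ≈ halfConv n (λ k j → r ⊗ f k j)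
  halfConv-distribˡ r zero          f = ≈-refl
  halfConv-distribˡ r (suc zero)    f = ≈-refl
  halfConv-distribˡ r (suc (suc n)) f = ≈-trans (distribˡ r _ _) (+-congˡ (halfConv-distribˡ r n _))

  -- The pairs a < b with a + b = n + 1 are exactly a = k, b = k + j + 1 with 2k + j = n; their
  -- mirror images contribute the same amount and the diagonal nothing. Each induction step removes
  -- the two end terms, which lowers n by 2.
  conv-fold : ∀ n h → (∀ a b → h a b ≈ h b a) → (∀ a → h a a ≈ 0#) →
    let half = halfConv n (λ k j → h k (suc (k +ℕ j))) in conv (suc n) h ≈ half ⊕ half
  conv-fold zero          h h-sym h-diag = +-congˡ (h-sym 1 0)
  conv-fold (suc zero)    h h-sym h-diag =
    +-congˡ (≈-trans (+-cong (h-diag 1) (h-sym 2 0)) (+-identityˡ _))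
  conv-fold (suc (suc n)) h h-sym h-diag = begin
    h 0 (3 +ℕ n) ⊕ conv (2 +ℕ n) (λ a b → h (suc a) b)                        ≈⟨ +-congˡ (conv-last (suc n) (λ a b → h (suc a) b)) ⟩
    h 0 (3 +ℕ n) ⊕ (conv (1 +ℕ n) (λ a b → h (suc a) (suc b)) ⊕ h (3 +ℕ n) 0) ≈⟨ +-congˡ (+-cong
        (conv-fold n _ (λ a b → h-sym (suc a) (suc b)) (λ a → h-diag (suc a))) (h-sym (3 +ℕ n) 0)) ⟩
    h 0 (3 +ℕ n) ⊕ ((half ⊕ half) ⊕ h 0 (3 +ℕ n))                             ≈⟨ +-congˡ (+-assoc _ _ _) ⟩
    h 0 (3 +ℕ n) ⊕ (half ⊕ (half ⊕ h 0 (3 +ℕ n)))                             ≈⟨ +-assoc _ _ _ ⟨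
    (h 0 (3 +ℕ n) ⊕ half) ⊕ (half ⊕ h 0 (3 +ℕ n))                             ≈⟨ +-congˡ (+-comm _ _) ⟩
    (h 0 (3 +ℕ n) ⊕ half) ⊕ (h 0 (3 +ℕ n) ⊕ half)                             ∎
    where half = halfConv n (λ k j → h (suc k) (suc (suc (k +ℕ j))))

-- Regrouping integer double sums by 2k + j

open FiniteSums ℤₚ.+-*-commutativeRing using ()
  renaming ( conv to convℤ; conv-cong to convℤ-cong; conv-+ to convℤ-+; conv-distribˡ to convℤ-distribˡ
           ; conv-flip to convℤ-flip; halfConv to halfConvℤ)
open CommutativeSemigroupProperties ℤₚ.+-commutativeSemigroup using (interchange)

sumℤ-cong : ∀ n {f g} → (∀ i → i < n → f i ≡ g i) → sumℤ n f ≡ sumℤ n g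
sumℤ-cong zero    f≡g = refl
sumℤ-cong (suc n) f≡g =
  cong₂ _+_ (sumℤ-cong n (λ i i<n → f≡g i (ℕₚ.m≤n⇒m≤1+n i<n))) (f≡g n ℕₚ.≤-refl)

sumℤ-zero : ∀ n f → (∀ i → i < n → f i ≡ 0ℤ) → sumℤ n f ≡ 0ℤ
sumℤ-zero zero    f f≡0 = refl
sumℤ-zero (suc n) f f≡0 =
  cong₂ _+_ (sumℤ-zero n f (λ i i<n → f≡0 i (ℕₚ.m≤n⇒m≤1+n i<n))) (f≡0 n ℕₚ.≤-refl)

sumℤ-head : ∀ n f → sumℤ (suc n) f ≡ f 0 + sumℤ n (λ i → f (suc i))
sumℤ-head zero    f = ℤₚ.+-comm 0ℤ (f 0)
sumℤ-head (suc n) f = trans (cong (_+ f (suc n)) (sumℤ-head n f)) (ℤₚ.+-assoc (f 0) _ _)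

sumℤ-extend : ∀ {m n} f → m ≤ n → (∀ i → m ≤ i → f i ≡ 0ℤ) → sumℤ n f ≡ sumℤ m f
sumℤ-extend {m} {zero}  f z≤n f≡0 = refl
sumℤ-extend {m} {suc n} f m≤1+n f≡0 with ℕₚ.m≤n⇒m<n∨m≡n m≤1+n
... | inj₁ (s≤s m≤n) = trans (cong₂ _+_ (sumℤ-extend f m≤n f≡0) (f≡0 n m≤n)) (ℤₚ.+-identityʳ _)
... | inj₂ refl = refl

-- Splits off the terms with k = 0. What remains is indexed by k + 1, whose group number is larger
-- by 2, so only n of the n + 2 groups are left.
sumℤ-halfConv : ∀ n s →
  sumℤ (suc (suc n)) (λ m → halfConvℤ m s) ≡
  sumℤ (suc (suc n)) (s 0) + sumℤ n (λ m → halfConvℤ m (λ k j → s (suc k) j))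
sumℤ-halfConv zero    s = sym (ℤₚ.+-identityʳ _)
sumℤ-halfConv (suc n) s = trans
  (cong (_+ (s 0 (suc (suc n)) + halfConvℤ n (λ k j → s (suc k) j))) (sumℤ-halfConv n s))
  (interchange (sumℤ (suc (suc n)) (s 0)) _ _ _)

-- Induction that removes the terms with k = 0. This costs 2 in n, 1 in K and nothing in J, so the
-- sides of the box have to be independent of n for the hypothesis to apply again.
sumℤ-box : ∀ n {K J} s → n ≤ K → n ≤ J → (∀ k j → n < k +ℕ (k +ℕ j) → s k j ≡ 0ℤ) →
  sumℤ (suc K) (λ k → sumℤ (suc J) (s k)) ≡ sumℤ (suc n) (λ m → halfConvℤ m s)
sumℤ-box n {K} {J} s n≤K n≤J s≡0 = begin
  sumℤ (suc K) (λ k → sumℤ (suc J) (s k))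
    ≡⟨ sumℤ-head K _ ⟩
  sumℤ (suc J) (s 0) + sumℤ K (λ k → sumℤ (suc J) (s (suc k)))
    ≡⟨ cong (_+ sumℤ K (λ k → sumℤ (suc J) (s (suc k)))) (sumℤ-extend (s 0) (s≤s n≤J) (s≡0 0)) ⟩
  sumℤ (suc n) (s 0) + sumℤ K (λ k → sumℤ (suc J) (s (suc k)))
    ≡⟨ rest n K n≤K n≤J s≡0 ⟩
  sumℤ (suc n) (λ m → halfConvℤ m s) ∎
  where
  open ≡-Reasoning
  rest-zero : ∀ K → (∀ k j → s (suc k) j ≡ 0ℤ) → sumℤ K (λ k → sumℤ (suc J) (s (suc k))) ≡ 0ℤ
  rest-zero K s≡0 = sumℤ-zero K _ (λ k _ → sumℤ-zero (suc J) _ (λ j _ → s≡0 k j))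
  2+2k : ∀ k j → suc k +ℕ (suc k +ℕ j) ≡ suc (suc (k +ℕ (k +ℕ j)))
  2+2k k j = cong suc (ℕₚ.+-suc k (k +ℕ j))
  2≤ : ∀ k j → 2 ≤ suc k +ℕ (suc k +ℕ j)
  2≤ k j rewrite 2+2k k j = s≤s (s≤s z≤n)
  rest : ∀ n K → n ≤ K → n ≤ J → (∀ k j → n < k +ℕ (k +ℕ j) → s k j ≡ 0ℤ) →
    sumℤ (suc n) (s 0) + sumℤ K (λ k → sumℤ (suc J) (s (suc k))) ≡ sumℤ (suc n) (λ m → halfConvℤ m s)
  rest zero          K       n≤K n≤J s≡0 = trans
    (cong (sumℤ 1 (s 0) +_) (rest-zero K (λ k j → s≡0 (suc k) j (s≤s z≤n)))) (ℤₚ.+-identityʳ _)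
  rest (suc zero)    K       n≤K n≤J s≡0 = trans
    (cong (sumℤ 2 (s 0) +_) (rest-zero K (λ k j → s≡0 (suc k) j (2≤ k j)))) (ℤₚ.+-identityʳ _)
  rest (suc (suc n)) (suc K) (s≤s 1+n≤K) n≤J s≡0 = trans
    (cong (sumℤ (suc (suc (suc n))) (s 0) +_)
      (sumℤ-box n (λ k j → s (suc k) j) (ℕₚ.<⇒≤ 1+n≤K) (ℕₚ.≤-trans (ℕₚ.m≤n+m n 2) n≤J) (λ k j lt →
        s≡0 (suc k) j (ℕₚ.≤-trans (s≤s (s≤s lt)) (ℕₚ.≤-reflexive (sym (2+2k k j)))))))
    (sym (sumℤ-halfConv (suc n) s))

-- The commutative ring of formal power series

*ₚ-conv : ∀ f g n → (f *ₚ g) n ≡ convℤ n (λ a b → f a * g b)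
*ₚ-conv f g zero    = ℤₚ.+-identityˡ _
*ₚ-conv f g (suc n) = trans (sumℤ-head (suc n) _) (cong (f 0 * g (suc n) +_) (*ₚ-conv (λ i → f (suc i)) g n))

*ₚ-suc : ∀ f g n → (f *ₚ g) (suc n) ≡ f 0 * g (suc n) + ((λ i → f (suc i)) *ₚ g) n
*ₚ-suc f g n = sumℤ-head (suc n) _

*ₚ-congₙ : ∀ {f f′ g g′} n → (∀ i → i ≤ n → f i ≡ f′ i) → (∀ i → i ≤ n → g i ≡ g′ i) →
           (f *ₚ g) n ≡ (f′ *ₚ g′) n
*ₚ-congₙ n f≡ g≡ = sumℤ-cong (suc n)
  (λ i i<1+n → cong₂ _*_ (f≡ i (ℕ.s≤s⁻¹ i<1+n)) (g≡ (n ∸ i) (ℕₚ.m∸n≤m n i)))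

*ₚ-cong : ∀ {f f′ g g′} → f ≈ₚ f′ → g ≈ₚ g′ → f *ₚ g ≈ₚ f′ *ₚ g′
*ₚ-cong f≈ g≈ n = *ₚ-congₙ n (λ i _ → f≈ i) (λ i _ → g≈ i)

*ₚ-comm : ∀ f g → f *ₚ g ≈ₚ g *ₚ f
*ₚ-comm f g n = begin
  (f *ₚ g) n                    ≡⟨ *ₚ-conv f g n ⟩
  convℤ n (λ a b → f a * g b)   ≡⟨ convℤ-flip n _ ⟩
  convℤ n (λ a b → f b * g a)   ≡⟨ convℤ-cong n (λ a b _ → ℤₚ.*-comm (f b) (g a)) ⟩
  convℤ n (λ a b → g a * f b)   ≡⟨ *ₚ-conv g f n ⟨
  (g *ₚ f) n                    ∎
  where open ≡-Reasoning

*ₚ-distribˡ : ∀ f g h → f *ₚ (g +ₚ h) ≈ₚ f *ₚ g +ₚ f *ₚ h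
*ₚ-distribˡ f g h n = begin
  (f *ₚ (g +ₚ h)) n                                           ≡⟨ *ₚ-conv f (g +ₚ h) n ⟩
  convℤ n (λ a b → f a * (g b + h b))                         ≡⟨ convℤ-cong n (λ a b _ → ℤₚ.*-distribˡ-+ (f a) (g b) (h b)) ⟩
  convℤ n (λ a b → f a * g b + f a * h b)                     ≡⟨ convℤ-+ n _ _ ⟨
  convℤ n (λ a b → f a * g b) + convℤ n (λ a b → f a * h b)   ≡⟨ cong₂ _+_ (*ₚ-conv f g n) (*ₚ-conv f h n) ⟨
  (f *ₚ g) n + (f *ₚ h) n                                     ∎
  where open ≡-Reasoning

*ₚ-distribʳ : ∀ f g h → (g +ₚ h) *ₚ f ≈ₚ g *ₚ f +ₚ h *ₚ f
*ₚ-distribʳ f g h n = trans (*ₚ-comm (g +ₚ h) f n)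
  (trans (*ₚ-distribˡ f g h n) (cong₂ _+_ (*ₚ-comm f g n) (*ₚ-comm f h n)))

scale-*ₚ : ∀ c f g → scale c f *ₚ g ≈ₚ scale c (f *ₚ g)
scale-*ₚ c f g n = begin
  (scale c f *ₚ g) n                    ≡⟨ *ₚ-conv (scale c f) g n ⟩
  convℤ n (λ a b → c * f a * g b)       ≡⟨ convℤ-cong n (λ a b _ → ℤₚ.*-assoc c (f a) (g b)) ⟩
  convℤ n (λ a b → c * (f a * g b))     ≡⟨ convℤ-distribˡ c n _ ⟨
  c * convℤ n (λ a b → f a * g b)       ≡⟨ cong (c *_) (*ₚ-conv f g n) ⟨
  c * (f *ₚ g) n                        ∎
  where open ≡-Reasoning

-- Induction on the coefficient for all series at once: deleting the constant term behaves like a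
-- derivation, (f g)⁺ = f₀ g⁺ + f⁺ g, and reduces coefficient n + 1 to coefficient n.
*ₚ-assoc : ∀ f g h → (f *ₚ g) *ₚ h ≈ₚ f *ₚ (g *ₚ h)
*ₚ-assoc f g h zero    = begin
  0ℤ + (0ℤ + f 0 * g 0) * h 0   ≡⟨ cong (λ z → 0ℤ + z * h 0) (ℤₚ.+-identityˡ (f 0 * g 0)) ⟩
  0ℤ + f 0 * g 0 * h 0          ≡⟨ cong (0ℤ +_) (ℤₚ.*-assoc (f 0) (g 0) (h 0)) ⟩
  0ℤ + f 0 * (g 0 * h 0)        ≡⟨ cong (λ z → 0ℤ + f 0 * z) (ℤₚ.+-identityˡ (g 0 * h 0)) ⟨
  0ℤ + f 0 * (0ℤ + g 0 * h 0)   ∎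
  where open ≡-Reasoning
*ₚ-assoc f g h (suc n) = begin
  ((f *ₚ g) *ₚ h) (suc n)
    ≡⟨ *ₚ-suc (f *ₚ g) h n ⟩
  (f *ₚ g) 0 * h (suc n) + ((λ i → (f *ₚ g) (suc i)) *ₚ h) n
    ≡⟨ cong₂ _+_ (cong (_* h (suc n)) (ℤₚ.+-identityˡ (f 0 * g 0)))
                 (*ₚ-cong {g = h} (*ₚ-suc f g) (λ _ → refl) n) ⟩
  f 0 * g 0 * h (suc n) + ((scale (f 0) g⁺ +ₚ f⁺ *ₚ g) *ₚ h) n
    ≡⟨ cong (f 0 * g 0 * h (suc n) +_) (*ₚ-distribʳ h (scale (f 0) g⁺) (f⁺ *ₚ g) n) ⟩
  f 0 * g 0 * h (suc n) + ((scale (f 0) g⁺ *ₚ h) n + ((f⁺ *ₚ g) *ₚ h) n)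
    ≡⟨ ℤₚ.+-assoc (f 0 * g 0 * h (suc n)) _ _ ⟨
  f 0 * g 0 * h (suc n) + (scale (f 0) g⁺ *ₚ h) n + ((f⁺ *ₚ g) *ₚ h) n
    ≡⟨ cong₂ _+_ (cong₂ _+_ (ℤₚ.*-assoc (f 0) (g 0) (h (suc n))) (scale-*ₚ (f 0) g⁺ h n)) (*ₚ-assoc f⁺ g h n) ⟩
  f 0 * (g 0 * h (suc n)) + f 0 * (g⁺ *ₚ h) n + (f⁺ *ₚ (g *ₚ h)) n
    ≡⟨ cong (_+ (f⁺ *ₚ (g *ₚ h)) n) (ℤₚ.*-distribˡ-+ (f 0) _ _) ⟨
  f 0 * (g 0 * h (suc n) + (g⁺ *ₚ h) n) + (f⁺ *ₚ (g *ₚ h)) n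
    ≡⟨ cong (λ z → f 0 * z + (f⁺ *ₚ (g *ₚ h)) n) (*ₚ-suc g h n) ⟨
  f 0 * (g *ₚ h) (suc n) + (f⁺ *ₚ (g *ₚ h)) n
    ≡⟨ *ₚ-suc f (g *ₚ h) n ⟨
  (f *ₚ (g *ₚ h)) (suc n) ∎
  where
  open ≡-Reasoning
  f⁺ = λ i → f (suc i)
  g⁺ = λ i → g (suc i)

zeroₚ : PS
zeroₚ _ = 0ℤ

zeroₚ-*ₚ : ∀ f → zeroₚ *ₚ f ≈ₚ zeroₚ
zeroₚ-*ₚ f n = sumℤ-zero (suc n) _ (λ i _ → ℤₚ.*-zeroˡ (f (n ∸ i)))

oneₚ-*ₚ : ∀ f → oneₚ *ₚ f ≈ₚ f
oneₚ-*ₚ f zero    = trans (ℤₚ.+-identityˡ _) (ℤₚ.*-identityˡ (f 0))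
oneₚ-*ₚ f (suc n) = trans (*ₚ-suc oneₚ f n)
  (trans (cong₂ _+_ (ℤₚ.*-identityˡ (f (suc n))) (zeroₚ-*ₚ f n)) (ℤₚ.+-identityʳ _))

*ₚ-oneₚ : ∀ f → f *ₚ oneₚ ≈ₚ f
*ₚ-oneₚ f n = trans (*ₚ-comm f oneₚ n) (oneₚ-*ₚ f n)

-- _≈ₚ_ as a record, so that unification can recover the two series from it.
infix 4 _≋_
record _≋_ (f g : PS) : Set where
  constructor coefficientwise
  field coefficient : f ≈ₚ g

open _≋_

PSRing : CommutativeRing 0ℓ 0ℓ
PSRing = record
  { Carrier = PS ; _≈_ = _≋_ ; _+_ = _+ₚ_ ; _*_ = _*ₚ_ ; -_ = λ f n → - f n ; 0# = zeroₚ ; 1# = oneₚ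
  ; isCommutativeRing = record
    { isRing = record
      { +-isAbelianGroup = record
        { isGroup = record
          { isMonoid = record
            { isSemigroup = record
              { isMagma = record
                { isEquivalence = record
                  { refl  = coefficientwise (λ _ → refl)
                  ; sym   = λ e → coefficientwise (λ n → sym (coefficient e n))
                  ; trans = λ d e → coefficientwise (λ n → trans (coefficient d n) (coefficient e n)) }
                ; ∙-cong = λ d e → coefficientwise (λ n → cong₂ _+_ (coefficient d n) (coefficient e n)) }
              ; assoc = λ f g h → coefficientwise (λ n → ℤₚ.+-assoc (f n) (g n) (h n)) }
            ; identity = (λ f → coefficientwise (λ n → ℤₚ.+-identityˡ (f n)))
                       , (λ f → coefficientwise (λ n → ℤₚ.+-identityʳ (f n))) }
          ; inverse = (λ f → coefficientwise (λ n → ℤₚ.+-inverseˡ (f n)))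
                    , (λ f → coefficientwise (λ n → ℤₚ.+-inverseʳ (f n)))
          ; ⁻¹-cong = λ e → coefficientwise (λ n → cong -_ (coefficient e n)) }
        ; comm = λ f g → coefficientwise (λ n → ℤₚ.+-comm (f n) (g n)) }
      ; *-cong = λ d e → coefficientwise (*ₚ-cong (coefficient d) (coefficient e))
      ; *-assoc = λ f g h → coefficientwise (*ₚ-assoc f g h)
      ; *-identity = (λ f → coefficientwise (oneₚ-*ₚ f)) , (λ f → coefficientwise (*ₚ-oneₚ f))
      ; distrib = (λ f g h → coefficientwise (*ₚ-distribˡ f g h)) , (λ f g h → coefficientwise (*ₚ-distribʳ f g h)) }
    ; *-comm = λ f g → coefficientwise (*ₚ-comm f g) } }

ℤ-rawRing : RawRing 0ℓ 0ℓ
ℤ-rawRing = CommutativeRing.rawRing ℤₚ.+-*-commutativeRing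

constants : ℤ-rawRing -Raw-AlmostCommutative⟶ fromCommutativeRing PSRing
constants = record
  { ⟦_⟧    = λ c → scale c oneₚ
  ; +-homo = λ c d → coefficientwise (λ n → ℤₚ.*-distribʳ-+ (oneₚ n) c d)
  ; *-homo = λ c d → coefficientwise (λ n → trans (ℤₚ.*-assoc c d (oneₚ n))
      (sym (trans (scale-*ₚ c oneₚ (scale d oneₚ) n) (cong (c *_) (oneₚ-*ₚ (scale d oneₚ) n)))))
  ; -‿homo = λ c → coefficientwise (λ n → sym (ℤₚ.neg-distribˡ-* c (oneₚ n)))
  ; 0-homo = coefficientwise (λ n → ℤₚ.*-zeroˡ (oneₚ n))
  ; 1-homo = coefficientwise (λ n → ℤₚ.*-identityˡ (oneₚ n))
  }

-- Arithmetic of the exponents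

triangle : ℕ → ℕ
triangle zero    = 0
triangle (suc n) = triangle n +ℕ n

-- binom₂ a b = (d choose 2) for the integer d = b - a.
binom₂ : ℕ → ℕ → ℕ
binom₂ zero    b       = triangle b
binom₂ (suc a) zero    = triangle (suc (suc a))
binom₂ (suc a) (suc b) = binom₂ a b

-- This is (-d choose 2) - (d choose 2) = d, rearranged to avoid subtraction.
binom₂-swap : ∀ a b → binom₂ b a +ℕ a ≡ binom₂ a b +ℕ b
binom₂-swap zero    zero    = refl
binom₂-swap zero    (suc b) = ℕₚ.+-identityʳ _
binom₂-swap (suc a) zero    = sym (ℕₚ.+-identityʳ _)
binom₂-swap (suc a) (suc b) = begin
  binom₂ b a +ℕ suc a    ≡⟨ ℕₚ.+-suc _ a ⟩
  suc (binom₂ b a +ℕ a)  ≡⟨ cong suc (binom₂-swap a b) ⟩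
  suc (binom₂ a b +ℕ b)  ≡⟨ ℕₚ.+-suc _ b ⟨
  binom₂ a b +ℕ suc b    ∎
  where open ≡-Reasoning

-- The polynomial d(d-1)/2 is invariant under d ↦ 1 - d.
binom₂-reflect : ∀ a b → binom₂ a b ≡ binom₂ b (suc a)
binom₂-reflect zero    zero          = refl
binom₂-reflect zero    (suc zero)    = refl
binom₂-reflect zero    (suc (suc b)) = refl
binom₂-reflect (suc a) zero          = refl
binom₂-reflect (suc a) (suc b)       = binom₂-reflect a b

-- Raising a lowers d by one, so this is Pascal's rule (d choose 2) - (d-1 choose 2) = d - 1 without
-- subtraction.
binom₂-sucˡ : ∀ a b → binom₂ (suc a) b +ℕ b ≡ binom₂ a b +ℕ suc a
binom₂-sucˡ zero    zero    = refl
binom₂-sucˡ (suc a) zero    = ℕₚ.+-identityʳ _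
binom₂-sucˡ zero    (suc b) = trans (ℕₚ.+-suc (triangle b) b) (sym (ℕₚ.+-comm _ 1))
binom₂-sucˡ (suc a) (suc b) = begin
  binom₂ (suc a) b +ℕ suc b    ≡⟨ ℕₚ.+-suc _ b ⟩
  suc (binom₂ (suc a) b +ℕ b)  ≡⟨ cong suc (binom₂-sucˡ a b) ⟩
  suc (binom₂ a b +ℕ suc a)    ≡⟨ ℕₚ.+-suc _ (suc a) ⟨
  binom₂ a b +ℕ suc (suc a)    ∎
  where open ≡-Reasoning

binom₂-right : ∀ k j → binom₂ k (k +ℕ j) ≡ triangle j
binom₂-right zero    j = refl
binom₂-right (suc k) j = binom₂-right k j

-- Here d = -(j+1), and (-m choose 2) = (m+1 choose 2).
binom₂-left : ∀ k j → binom₂ (suc (k +ℕ j)) k ≡ triangle (suc (suc j))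
binom₂-left zero    j = refl
binom₂-left (suc k) j = binom₂-left k j

even-exponent : ∀ j → 1 *ℕ (2 *ℕ j +ℕ 2) ≡ 2 *ℕ suc j
even-exponent = solve 1 (λ j → con 1 :* (con 2 :* j :+ con 2) := con 2 :* (con 1 :+ j)) refl
  where open +-*-Solver

-- Since `triangle j` is (j choose 2), one has j² = j + 2 (j choose 2). The power of q thus splits
-- into q^M, constant on the group M = 2k + j, and x^(j choose 2).
summand-exponent : ∀ k j → 2 *ℕ k +ℕ j *ℕ j ≡ k +ℕ (k +ℕ j) +ℕ 2 *ℕ triangle j
summand-exponent k j = trans (cong (2 *ℕ k +ℕ_) (square j))
  (solve 3 (λ k j t → con 2 :* k :+ (j :+ con 2 :* t) := k :+ (k :+ j) :+ con 2 :* t) refl k j (triangle j))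
  where
  open +-*-Solver
  square : ∀ j → j *ℕ j ≡ j +ℕ 2 *ℕ triangle j
  square zero    = refl
  square (suc j) = begin
    suc j *ℕ suc j                         ≡⟨ solve 1 (λ j → (con 1 :+ j) :* (con 1 :+ j) := con 1 :+ (con 2 :* j :+ j :* j)) refl j ⟩
    1 +ℕ (2 *ℕ j +ℕ j *ℕ j)                ≡⟨ cong (λ s → 1 +ℕ (2 *ℕ j +ℕ s)) (square j) ⟩
    1 +ℕ (2 *ℕ j +ℕ (j +ℕ 2 *ℕ triangle j))
      ≡⟨ solve 2 (λ j t → con 1 :+ (con 2 :* j :+ (j :+ con 2 :* t)) := con 1 :+ j :+ con 2 :* (t :+ j)) refl j (triangle j) ⟩
    suc j +ℕ 2 *ℕ triangle (suc j)         ∎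
    where open ≡-Reasoning

-- The q-series identities over an abstract commutative ring

module QSeries
  (R : CommutativeRing 0ℓ 0ℓ)
  (constants : ℤ-rawRing -Raw-AlmostCommutative⟶ fromCommutativeRing R)
  (q^ : ℕ → CommutativeRing.Carrier R)
  (q^-zero : CommutativeRing._≈_ R (q^ 0) (CommutativeRing.1# R))
  (q^-+ : ∀ m n → CommutativeRing._≈_ R (q^ (m +ℕ n)) (CommutativeRing._*_ R (q^ m) (q^ n)))
  where

  open CommutativeRing R
    renaming ( Carrier to C; _+_ to _⊕_; _*_ to _⊗_; _-_ to _⊖_; -_ to neg
             ; refl to ≈-refl; sym to ≈-sym; trans to ≈-trans; reflexive to ≈-reflexive )
  open SetoidReasoning setoid
  open import Algebra.Properties.Semiring.Exp semiring using (_^_; ^-homo-*)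
  open FiniteSums R
  open _-Raw-AlmostCommutative⟶_ constants
  open import Data.Integer using (+_; -[1+_])

  -- Equal to ⟦_⟧, but with 0 and 1 denoting 0# and 1# definitionally, as the ring solver's goals need.
  constant : ℤ → C
  constant (+ 0) = 0#
  constant (+ 1) = 1#
  constant c     = ⟦ c ⟧

  constant-⟦⟧ : ∀ c → constant c ≈ ⟦ c ⟧
  constant-⟦⟧ (+ 0)             = ≈-sym 0-homo
  constant-⟦⟧ (+ 1)             = ≈-sym 1-homo
  constant-⟦⟧ (+ suc (suc n))   = ≈-refl
  constant-⟦⟧ -[1+ n ]          = ≈-refl

  constantMorphism : ℤ-rawRing -Raw-AlmostCommutative⟶ fromCommutativeRing R
  constantMorphism = record
    { ⟦_⟧    = constant
    ; +-homo = λ c d → ≈-trans (constant-⟦⟧ (c + d))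
        (≈-trans (+-homo c d) (≈-sym (+-cong (constant-⟦⟧ c) (constant-⟦⟧ d))))
    ; *-homo = λ c d → ≈-trans (constant-⟦⟧ (c * d))
        (≈-trans (*-homo c d) (≈-sym (*-cong (constant-⟦⟧ c) (constant-⟦⟧ d))))
    ; -‿homo = λ c → ≈-trans (constant-⟦⟧ (- c))
        (≈-trans (-‿homo c) (≈-sym (-‿cong (constant-⟦⟧ c))))
    ; 0-homo = ≈-refl
    ; 1-homo = ≈-refl
    }

  coefficient≟ : ∀ c d → Maybe (constant c ≈ constant d)
  coefficient≟ c d with c ℤₚ.≟ d
  ... | yes refl = just ≈-refl
  ... | no _     = nothing

  open RingSolver ℤ-rawRing (fromCommutativeRing R) constantMorphism coefficient≟
    using (solve; _:=_; _:+_; _:*_; _:-_; :-_; con)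

  inverse-unique : ∀ {a b c} → a ⊗ b ≈ 1# → a ⊗ c ≈ 1# → b ≈ c
  inverse-unique {a} {b} {c} ab≈1 ac≈1 = begin
    b            ≈⟨ *-identityʳ b ⟨
    b ⊗ 1#       ≈⟨ *-congˡ ac≈1 ⟨
    b ⊗ (a ⊗ c)  ≈⟨ solve 3 (λ a b c → b :* (a :* c) := c :* (a :* b)) ≈-refl a b c ⟩
    c ⊗ (a ⊗ b)  ≈⟨ *-congˡ ab≈1 ⟩
    c ⊗ 1#       ≈⟨ *-identityʳ c ⟩
    c            ∎

  cancel-unit : ∀ {a b c d} → a ⊗ d ≈ 1# → a ⊗ b ≈ a ⊗ c → b ≈ c
  cancel-unit {a} {b} {c} {d} ad≈1 ab≈ac = begin
    b            ≈⟨ *-identityˡ b ⟨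
    1# ⊗ b       ≈⟨ *-congʳ ad≈1 ⟨
    a ⊗ d ⊗ b    ≈⟨ solve 3 (λ a b d → a :* d :* b := d :* (a :* b)) ≈-refl a b d ⟩
    d ⊗ (a ⊗ b)  ≈⟨ *-congˡ ab≈ac ⟩
    d ⊗ (a ⊗ c)  ≈⟨ solve 3 (λ a c d → d :* (a :* c) := a :* d :* c) ≈-refl a c d ⟩
    a ⊗ d ⊗ c    ≈⟨ *-congʳ ad≈1 ⟩
    1# ⊗ c       ≈⟨ *-identityˡ c ⟩
    c            ∎

  x^ p^ : ℕ → C
  x^ n = q^ (2 *ℕ n)
  p^ n = q^ (4 *ℕ n)

  x^-+ : ∀ m n → x^ (m +ℕ n) ≈ x^ m ⊗ x^ n
  x^-+ m n = ≈-trans (≈-reflexive (cong q^ (ℕₚ.*-distribˡ-+ 2 m n))) (q^-+ (2 *ℕ m) (2 *ℕ n))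

  p^-x^ : ∀ n → p^ n ≈ x^ n ⊗ x^ n
  p^-x^ n = ≈-trans (≈-reflexive (cong q^ eq)) (q^-+ (2 *ℕ n) (2 *ℕ n))
    where eq : 4 *ℕ n ≡ 2 *ℕ n +ℕ 2 *ℕ n
          eq = ℕₚ.*-distribʳ-+ n 2 2

  module Pochhammer
    (U u W w : ℕ → C)
    (U-zero : U 0 ≈ 1#) (U-suc : ∀ n → U (suc n) ≈ U n ⊗ (1# ⊖ p^ (suc n))) (U-inverse : ∀ n → U n ⊗ u n ≈ 1#)
    (W-zero : W 0 ≈ 1#) (W-suc : ∀ n → W (suc n) ≈ W n ⊗ (1# ⊖ x^ (suc n))) (W-inverse : ∀ n → W n ⊗ w n ≈ 1#)
    where

    u-suc : ∀ n → u n ≈ (1# ⊖ x^ (suc n) ⊗ x^ (suc n)) ⊗ u (suc n)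
    u-suc n = inverse-unique (U-inverse n) (begin
      U n ⊗ ((1# ⊖ x^ (suc n) ⊗ x^ (suc n)) ⊗ u (suc n))  ≈⟨ *-assoc _ _ _ ⟨
      U n ⊗ (1# ⊖ x^ (suc n) ⊗ x^ (suc n)) ⊗ u (suc n)    ≈⟨ *-congʳ (*-congˡ (+-congˡ (-‿cong (p^-x^ (suc n))))) ⟨
      U n ⊗ (1# ⊖ p^ (suc n)) ⊗ u (suc n)                 ≈⟨ *-congʳ (U-suc n) ⟨
      U (suc n) ⊗ u (suc n)                               ≈⟨ U-inverse (suc n) ⟩
      1#                                                  ∎)

    w-suc : ∀ n → w n ≈ (1# ⊖ x^ (suc n)) ⊗ w (suc n)
    w-suc n = inverse-unique (W-inverse n) (begin
      W n ⊗ ((1# ⊖ x^ (suc n)) ⊗ w (suc n))  ≈⟨ *-assoc _ _ _ ⟨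
      W n ⊗ (1# ⊖ x^ (suc n)) ⊗ w (suc n)    ≈⟨ *-congʳ (W-suc n) ⟨
      W (suc n) ⊗ w (suc n)                  ≈⟨ W-inverse (suc n) ⟩
      1#                                     ∎)

    u-zero : u 0 ≈ 1#
    u-zero = inverse-unique (U-inverse 0) (≈-trans (*-congʳ U-zero) (*-identityˡ 1#))

    -- Raising a in the exponent only gives `shifted` the exponent (d-1 choose 2), the one that
    -- occurs in the summands of the theorem.
    term shifted : ℕ → ℕ → C
    term    a b = x^ (binom₂ a b) ⊗ (u a ⊗ u b)
    shifted a b = x^ (binom₂ (suc a) b) ⊗ (u a ⊗ u b)

    G : ℕ → C
    G n = conv n term

    -- By reflection, the term (a, b) of group n becomes a term at (a+1, b) of group n + 1 with the
    -- mirrored exponent (-d choose 2) and the factor 1 - x^2a, where a and d now refer to the new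
    -- pair. This factor vanishes at a = 0, so the missing end term can be added. Its second half
    -- raises the exponent to (-d choose 2) + 2a = (d choose 2) + a + b, which is where x^(n+1)
    -- comes from.
    G-suc : ∀ n → G n ≈ (1# ⊖ x^ (suc n)) ⊗ G (suc n)
    G-suc n = begin
      G n
        ≈⟨ conv-cong n (λ a b _ → *-cong (≈-reflexive (cong x^ (binom₂-reflect a b))) (*-congʳ (u-suc a))) ⟩
      conv n (λ a b → h (suc a) b)
        ≈⟨ +-identityˡ _ ⟨
      0# ⊕ conv n (λ a b → h (suc a) b)
        ≈⟨ +-congʳ h-zero ⟨
      conv (suc n) h
        ≈⟨ conv-cong (suc n) split ⟩
      conv (suc n) (λ a b → term b a ⊕ neg (x^ (suc n)) ⊗ term a b)
        ≈⟨ conv-+ (suc n) (λ a b → term b a) (λ a b → neg (x^ (suc n)) ⊗ term a b) ⟨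
      conv (suc n) (λ a b → term b a) ⊕ conv (suc n) (λ a b → neg (x^ (suc n)) ⊗ term a b)
        ≈⟨ +-cong (≈-sym (conv-flip (suc n) term)) (≈-sym (conv-distribˡ _ (suc n) term)) ⟩
      G (suc n) ⊕ neg (x^ (suc n)) ⊗ G (suc n)
        ≈⟨ solve 2 (λ y g → g :+ :- y :* g := (con 1ℤ :- y) :* g) ≈-refl (x^ (suc n)) (G (suc n)) ⟩
      (1# ⊖ x^ (suc n)) ⊗ G (suc n)
        ∎
      where
      h : ℕ → ℕ → C
      h a b = x^ (binom₂ b a) ⊗ (((1# ⊖ x^ a ⊗ x^ a) ⊗ u a) ⊗ u b)
      h-zero : h 0 (suc n) ≈ 0#
      h-zero = begin
        e ⊗ (((1# ⊖ x^ 0 ⊗ x^ 0) ⊗ u 0) ⊗ u (suc n))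
          ≈⟨ *-congˡ (*-congʳ (*-congʳ (+-congˡ (-‿cong (*-cong q^-zero q^-zero))))) ⟩
        e ⊗ (((1# ⊖ 1# ⊗ 1#) ⊗ u 0) ⊗ u (suc n))
          ≈⟨ solve 3 (λ e v w → e :* (((con 1ℤ :- con 1ℤ :* con 1ℤ) :* v) :* w) := con 0ℤ) ≈-refl e (u 0) (u (suc n)) ⟩
        0# ∎
        where e = x^ (binom₂ (suc n) 0)
      split : ∀ a b → a +ℕ b ≡ suc n → h a b ≈ term b a ⊕ neg (x^ (suc n)) ⊗ term a b
      split a b a+b≡1+n = begin
        x^ (binom₂ b a) ⊗ (((1# ⊖ x^ a ⊗ x^ a) ⊗ u a) ⊗ u b)
          ≈⟨ solve 4 (λ e y v w → e :* (((con 1ℤ :- y :* y) :* v) :* w) :=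
               e :* (w :* v) :+ :- (e :* y :* y) :* (v :* w)) ≈-refl (x^ (binom₂ b a)) (x^ a) (u a) (u b) ⟩
        term b a ⊕ neg (x^ (binom₂ b a) ⊗ x^ a ⊗ x^ a) ⊗ (u a ⊗ u b)
          ≈⟨ +-congˡ (*-congʳ (-‿cong exponents)) ⟩
        term b a ⊕ neg (x^ (suc n) ⊗ x^ (binom₂ a b)) ⊗ (u a ⊗ u b)
          ≈⟨ +-congˡ (solve 3 (λ y e z → :- (y :* e) :* z := :- y :* (e :* z)) ≈-refl
               (x^ (suc n)) (x^ (binom₂ a b)) (u a ⊗ u b)) ⟩
        term b a ⊕ neg (x^ (suc n)) ⊗ term a b ∎
        where
        exponents : x^ (binom₂ b a) ⊗ x^ a ⊗ x^ a ≈ x^ (suc n) ⊗ x^ (binom₂ a b)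
        exponents = begin
          x^ (binom₂ b a) ⊗ x^ a ⊗ x^ a  ≈⟨ *-congʳ (x^-+ (binom₂ b a) a) ⟨
          x^ (binom₂ b a +ℕ a) ⊗ x^ a    ≡⟨ cong (λ i → x^ i ⊗ x^ a) (binom₂-swap a b) ⟩
          x^ (binom₂ a b +ℕ b) ⊗ x^ a    ≈⟨ *-congʳ (x^-+ (binom₂ a b) b) ⟩
          x^ (binom₂ a b) ⊗ x^ b ⊗ x^ a  ≈⟨ solve 3 (λ e y z → e :* y :* z := z :* y :* e) ≈-refl (x^ (binom₂ a b)) (x^ b) (x^ a) ⟩
          x^ a ⊗ x^ b ⊗ x^ (binom₂ a b)  ≈⟨ *-congʳ (x^-+ a b) ⟨
          x^ (a +ℕ b) ⊗ x^ (binom₂ a b)  ≡⟨ cong (λ i → x^ i ⊗ x^ (binom₂ a b)) a+b≡1+n ⟩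
          x^ (suc n) ⊗ x^ (binom₂ a b)   ∎

    G-w : ∀ n → G n ≈ w n
    G-w n = inverse-unique (W-G n) (W-inverse n)
      where
      W-G : ∀ n → W n ⊗ G n ≈ 1#
      W-G zero    = ≈-trans (*-cong W-zero (*-cong q^-zero (*-cong u-zero u-zero)))
        (solve 0 (con 1ℤ :* (con 1ℤ :* (con 1ℤ :* con 1ℤ)) := con 1ℤ) ≈-refl)
      W-G (suc n) = begin
        W (suc n) ⊗ G (suc n)                  ≈⟨ *-congʳ (W-suc n) ⟩
        W n ⊗ (1# ⊖ x^ (suc n)) ⊗ G (suc n)    ≈⟨ *-assoc _ _ _ ⟩
        W n ⊗ ((1# ⊖ x^ (suc n)) ⊗ G (suc n))  ≈⟨ *-congˡ (G-suc n) ⟨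
        W n ⊗ G n                              ≈⟨ W-G n ⟩
        1#                                     ∎

    -- Evaluates the full sum of `shifted`. This time 1 - x^2b is absorbed into u b, and raising b
    -- turns the exponent of `term` into that of `shifted` without reflection. The second half has
    -- exponent (d-1 choose 2) + 2b = (d choose 2) + a + 1 + b, hence x^(n+2).
    G-shifted : ∀ n → G n ≈ conv (suc n) shifted ⊕ neg (x^ (suc (suc n))) ⊗ G (suc n)
    G-shifted n = begin
      G n
        ≈⟨ conv-cong n (λ a b _ → *-congˡ (*-congˡ (u-suc b))) ⟩
      conv n (λ a b → h a (suc b))
        ≈⟨ +-identityʳ _ ⟨
      conv n (λ a b → h a (suc b)) ⊕ 0#
        ≈⟨ +-congˡ h-zero ⟨
      conv n (λ a b → h a (suc b)) ⊕ h (suc n) 0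
        ≈⟨ conv-last n h ⟨
      conv (suc n) h
        ≈⟨ conv-cong (suc n) split ⟩
      conv (suc n) (λ a b → shifted a b ⊕ neg (x^ (suc (suc n))) ⊗ term a b)
        ≈⟨ conv-+ (suc n) shifted (λ a b → neg (x^ (suc (suc n))) ⊗ term a b) ⟨
      conv (suc n) shifted ⊕ conv (suc n) (λ a b → neg (x^ (suc (suc n))) ⊗ term a b)
        ≈⟨ +-congˡ (conv-distribˡ _ (suc n) term) ⟨
      conv (suc n) shifted ⊕ neg (x^ (suc (suc n))) ⊗ G (suc n)
        ∎
      where
      h : ℕ → ℕ → C
      h a b = x^ (binom₂ (suc a) b) ⊗ (u a ⊗ ((1# ⊖ x^ b ⊗ x^ b) ⊗ u b))
      h-zero : h (suc n) 0 ≈ 0#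
      h-zero = begin
        e ⊗ (u (suc n) ⊗ ((1# ⊖ x^ 0 ⊗ x^ 0) ⊗ u 0))
          ≈⟨ *-congˡ (*-congˡ (*-congʳ (+-congˡ (-‿cong (*-cong q^-zero q^-zero))))) ⟩
        e ⊗ (u (suc n) ⊗ ((1# ⊖ 1# ⊗ 1#) ⊗ u 0))
          ≈⟨ solve 3 (λ e v w → e :* (w :* ((con 1ℤ :- con 1ℤ :* con 1ℤ) :* v)) := con 0ℤ) ≈-refl e (u 0) (u (suc n)) ⟩
        0# ∎
        where e = x^ (binom₂ (suc (suc n)) 0)
      split : ∀ a b → a +ℕ b ≡ suc n → h a b ≈ shifted a b ⊕ neg (x^ (suc (suc n))) ⊗ term a b
      split a b a+b≡1+n = begin
        x^ (binom₂ (suc a) b) ⊗ (u a ⊗ ((1# ⊖ x^ b ⊗ x^ b) ⊗ u b))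
          ≈⟨ solve 4 (λ e y v w → e :* (v :* ((con 1ℤ :- y :* y) :* w)) :=
               e :* (v :* w) :+ :- (e :* y :* y) :* (v :* w)) ≈-refl (x^ (binom₂ (suc a) b)) (x^ b) (u a) (u b) ⟩
        shifted a b ⊕ neg (x^ (binom₂ (suc a) b) ⊗ x^ b ⊗ x^ b) ⊗ (u a ⊗ u b)
          ≈⟨ +-congˡ (*-congʳ (-‿cong exponents)) ⟩
        shifted a b ⊕ neg (x^ (suc (suc n)) ⊗ x^ (binom₂ a b)) ⊗ (u a ⊗ u b)
          ≈⟨ +-congˡ (solve 3 (λ y e z → :- (y :* e) :* z := :- y :* (e :* z)) ≈-refl
               (x^ (suc (suc n))) (x^ (binom₂ a b)) (u a ⊗ u b)) ⟩
        shifted a b ⊕ neg (x^ (suc (suc n))) ⊗ term a b ∎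
        where
        exponents : x^ (binom₂ (suc a) b) ⊗ x^ b ⊗ x^ b ≈ x^ (suc (suc n)) ⊗ x^ (binom₂ a b)
        exponents = begin
          x^ (binom₂ (suc a) b) ⊗ x^ b ⊗ x^ b    ≈⟨ *-congʳ (x^-+ (binom₂ (suc a) b) b) ⟨
          x^ (binom₂ (suc a) b +ℕ b) ⊗ x^ b      ≡⟨ cong (λ i → x^ i ⊗ x^ b) (binom₂-sucˡ a b) ⟩
          x^ (binom₂ a b +ℕ suc a) ⊗ x^ b        ≈⟨ *-congʳ (x^-+ (binom₂ a b) (suc a)) ⟩
          x^ (binom₂ a b) ⊗ x^ (suc a) ⊗ x^ b    ≈⟨ solve 3 (λ e y z → e :* y :* z := y :* z :* e) ≈-refl (x^ (binom₂ a b)) (x^ (suc a)) (x^ b) ⟩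
          x^ (suc a) ⊗ x^ b ⊗ x^ (binom₂ a b)    ≈⟨ *-congʳ (x^-+ (suc a) b) ⟨
          x^ (suc (a +ℕ b)) ⊗ x^ (binom₂ a b)    ≡⟨ cong (λ i → x^ (suc i) ⊗ x^ (binom₂ a b)) a+b≡1+n ⟩
          x^ (suc (suc n)) ⊗ x^ (binom₂ a b)     ∎

    -- ψ a b is u a ⊗ u b times x^(d-1 choose 2) (1 - x^d) (1 - x^2d), d = b - a, which is even in d.
    ψ : ℕ → ℕ → C
    ψ a b = (shifted a b ⊕ shifted b a) ⊕ neg (x^ 1) ⊗ (term a b ⊕ term b a)

    ψ-sym : ∀ a b → ψ a b ≈ ψ b a
    ψ-sym a b = +-cong (+-comm _ _) (*-congˡ (+-comm _ _))

    ψ-diagonal : ∀ a → ψ a a ≈ 0#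
    ψ-diagonal a = begin
      ψ a a
        ≈⟨ +-cong (+-cong s s) (*-congˡ (+-cong t t)) ⟩
      (x^ 1 ⊗ v ⊕ x^ 1 ⊗ v) ⊕ neg (x^ 1) ⊗ (1# ⊗ v ⊕ 1# ⊗ v)
        ≈⟨ solve 2 (λ y v → (y :* v :+ y :* v) :+ :- y :* (con 1ℤ :* v :+ con 1ℤ :* v) := con 0ℤ) ≈-refl (x^ 1) v ⟩
      0# ∎
      where
      v = u a ⊗ u a
      binom₂-diagonal : ∀ a → binom₂ a a ≡ 0
      binom₂-diagonal zero    = refl
      binom₂-diagonal (suc a) = binom₂-diagonal a
      binom₂-subdiagonal : ∀ a → binom₂ (suc a) a ≡ 1
      binom₂-subdiagonal zero    = refl
      binom₂-subdiagonal (suc a) = binom₂-subdiagonal a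
      s : shifted a a ≈ x^ 1 ⊗ v
      s = *-congʳ (≈-reflexive (cong x^ (binom₂-subdiagonal a)))
      t : term a a ≈ 1# ⊗ v
      t = *-congʳ (≈-trans (≈-reflexive (cong x^ (binom₂-diagonal a))) q^-zero)

    -- Here d = j + 1. Expanding (1 - x^d) (1 - x^2d) gives four terms, and (d-1 choose 2) increased
    -- by d, 2d and 3d equals 1 + (d choose 2), 1 + (-d choose 2) and (-d-1 choose 2); these are the
    -- four constituents of `ψ`.
    ψ-upper : ∀ k j → ψ k (suc (k +ℕ j)) ≈
      x^ (triangle j) ⊗ (1# ⊖ x^ (suc j)) ⊗ (1# ⊖ p^ (suc j)) ⊗ (u k ⊗ u (suc (k +ℕ j)))
    ψ-upper k j = begin
      ψ k n
        ≈⟨ +-cong (+-cong s₀ s₃) (*-congˡ (+-cong s₁ s₂)) ⟩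
      (t ⊗ (v ⊗ v′) ⊕ t ⊗ z ⊗ (y ⊗ z) ⊗ (y ⊗ (y ⊗ z)) ⊗ (v′ ⊗ v)) ⊕ neg y ⊗ (t ⊗ z ⊗ (v ⊗ v′) ⊕ t ⊗ z ⊗ (y ⊗ z) ⊗ (v′ ⊗ v))
        ≈⟨ solve 5 (λ t y z v v′ →
             (t :* (v :* v′) :+ t :* z :* (y :* z) :* (y :* (y :* z)) :* (v′ :* v)) :+
               :- y :* (t :* z :* (v :* v′) :+ t :* z :* (y :* z) :* (v′ :* v)) :=
             t :* (con 1ℤ :- y :* z) :* (con 1ℤ :- (y :* z) :* (y :* z)) :* (v :* v′)) ≈-refl t y z v v′ ⟩
      t ⊗ (1# ⊖ y ⊗ z) ⊗ (1# ⊖ (y ⊗ z) ⊗ (y ⊗ z)) ⊗ (v ⊗ v′)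
        ≈⟨ *-congʳ (*-cong (*-congˡ (+-congˡ (-‿cong (x^-+ 1 j))))
             (+-congˡ (-‿cong (≈-trans (p^-x^ (suc j)) (*-cong (x^-+ 1 j) (x^-+ 1 j)))))) ⟨
      t ⊗ (1# ⊖ x^ (suc j)) ⊗ (1# ⊖ p^ (suc j)) ⊗ (v ⊗ v′)
        ∎
      where
      n = suc (k +ℕ j)
      t = x^ (triangle j)
      y = x^ 1
      z = x^ j
      v = u k
      v′ = u n
      t₁ : x^ (triangle (suc j)) ≈ t ⊗ z
      t₁ = x^-+ (triangle j) j
      t₂ : x^ (triangle (suc (suc j))) ≈ t ⊗ z ⊗ (y ⊗ z)
      t₂ = ≈-trans (x^-+ (triangle (suc j)) (suc j)) (*-cong t₁ (x^-+ 1 j))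
      t₃ : x^ (triangle (suc (suc (suc j)))) ≈ t ⊗ z ⊗ (y ⊗ z) ⊗ (y ⊗ (y ⊗ z))
      t₃ = ≈-trans (x^-+ (triangle (suc (suc j))) (suc (suc j)))
        (*-cong t₂ (≈-trans (x^-+ 1 (suc j)) (*-congˡ (x^-+ 1 j))))
      s₀ : shifted k n ≈ t ⊗ (v ⊗ v′)
      s₀ = *-congʳ (≈-reflexive (cong x^ (binom₂-right k j)))
      s₁ : term k n ≈ t ⊗ z ⊗ (v ⊗ v′)
      s₁ = *-congʳ (≈-trans
        (≈-reflexive (cong x^ (trans (cong (binom₂ k) (sym (ℕₚ.+-suc k j))) (binom₂-right k (suc j))))) t₁)
      s₂ : term n k ≈ t ⊗ z ⊗ (y ⊗ z) ⊗ (v′ ⊗ v)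
      s₂ = *-congʳ (≈-trans (≈-reflexive (cong x^ (binom₂-left k j))) t₂)
      s₃ : shifted n k ≈ t ⊗ z ⊗ (y ⊗ z) ⊗ (y ⊗ (y ⊗ z)) ⊗ (v′ ⊗ v)
      s₃ = *-congʳ (≈-trans (≈-reflexive (cong x^
        (trans (cong (λ i → binom₂ (suc i) k) (sym (ℕₚ.+-suc k j))) (binom₂-left k (suc j))))) t₃)

    -- The full symmetric sum of `ψ` is twice S - x G (n+1), with S the sum of `shifted`, because
    -- mirroring the pairs does not change a full sum. The 2 stays on both sides.
    halfConv-ψ : ∀ n → let half = halfConv n (λ k j → ψ k (suc (k +ℕ j))) ; r = (1# ⊖ x^ 1) ⊗ w n in
      half ⊕ half ≈ r ⊕ r
    halfConv-ψ n = begin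
      half ⊕ half
        ≈⟨ conv-fold n ψ ψ-sym ψ-diagonal ⟨
      conv (suc n) ψ
        ≈⟨ conv-+ (suc n) (λ a b → shifted a b ⊕ shifted b a) (λ a b → neg (x^ 1) ⊗ (term a b ⊕ term b a)) ⟨
      conv (suc n) (λ a b → shifted a b ⊕ shifted b a) ⊕ conv (suc n) (λ a b → neg (x^ 1) ⊗ (term a b ⊕ term b a))
        ≈⟨ +-cong (symmetrised shifted) (≈-trans (≈-sym (conv-distribˡ (neg (x^ 1)) (suc n) (λ a b → term a b ⊕ term b a))) (*-congˡ (symmetrised term))) ⟩
      (S ⊕ S) ⊕ neg (x^ 1) ⊗ (G′ ⊕ G′)
        ≈⟨ solve 3 (λ s y g → (s :+ s) :+ :- y :* (g :+ g) := (s :- y :* g) :+ (s :- y :* g)) ≈-refl S (x^ 1) G′ ⟩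
      (S ⊖ x^ 1 ⊗ G′) ⊕ (S ⊖ x^ 1 ⊗ G′)
        ≈⟨ +-cong S-value S-value ⟩
      r ⊕ r ∎
      where
      half = halfConv n (λ k j → ψ k (suc (k +ℕ j)))
      r = (1# ⊖ x^ 1) ⊗ w n
      S = conv (suc n) shifted
      G′ = G (suc n)
      symmetrised : ∀ f → conv (suc n) (λ a b → f a b ⊕ f b a) ≈ conv (suc n) f ⊕ conv (suc n) f
      symmetrised f = ≈-trans (≈-sym (conv-+ (suc n) f (λ a b → f b a))) (+-congˡ (≈-sym (conv-flip (suc n) f)))
      S-value : S ⊖ x^ 1 ⊗ G′ ≈ r
      S-value = begin
        S ⊖ x^ 1 ⊗ G′
          -- Inserting x · x^(n+1) G (n+1) with both signs creates two known combinations: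
          -- `G-shifted` evaluates the first, `G-suc` the second, each to G n.
          ≈⟨ solve 4 (λ s x y g → s :- x :* g := (s :+ :- (x :* y) :* g) :- x :* ((con 1ℤ :- y) :* g)) ≈-refl
               S (x^ 1) (x^ (suc n)) G′ ⟩
        (S ⊕ neg (x^ 1 ⊗ x^ (suc n)) ⊗ G′) ⊖ x^ 1 ⊗ ((1# ⊖ x^ (suc n)) ⊗ G′)
          ≈⟨ +-cong (+-congˡ (*-congʳ (-‿cong (≈-sym (x^-+ 1 (suc n)))))) (-‿cong (*-congˡ (≈-sym (G-suc n)))) ⟩
        (S ⊕ neg (x^ (suc (suc n))) ⊗ G′) ⊖ x^ 1 ⊗ G n
          ≈⟨ +-congʳ (G-shifted n) ⟨
        G n ⊖ x^ 1 ⊗ G n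
          ≈⟨ solve 2 (λ g x → g :- x :* g := (con 1ℤ :- x) :* g) ≈-refl (G n) (x^ 1) ⟩
        (1# ⊖ x^ 1) ⊗ G n
          ≈⟨ *-congˡ (G-w n) ⟩
        r ∎

    -- The coefficients of Φ and its functional equation

    A : ℕ → C
    A n = U n ⊗ (w n ⊗ w n)

    A-zero : A 0 ≈ 1#
    A-zero = begin
      U 0 ⊗ (w 0 ⊗ w 0)  ≈⟨ *-cong U-zero (*-cong w-zero w-zero) ⟩
      1# ⊗ (1# ⊗ 1#)     ≈⟨ solve 0 (con 1ℤ :* (con 1ℤ :* con 1ℤ) := con 1ℤ) ≈-refl ⟩
      1#                 ∎
      where
      w-zero : w 0 ≈ 1#
      w-zero = inverse-unique (W-inverse 0) (≈-trans (*-congʳ W-zero) (*-identityˡ 1#))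

    -- With y = x^(n+1), the new factor 1 - y² of (p;p) splits as (1 - y) (1 + y); together with the
    -- spare 1 - y this supplies one factor for each of the two copies of w.
    A-suc : ∀ n → A (suc n) ⊗ (1# ⊖ x^ (suc n)) ≈ A n ⊗ (1# ⊕ x^ (suc n))
    A-suc n = begin
      U (suc n) ⊗ (w′ ⊗ w′) ⊗ (1# ⊖ y)
        ≈⟨ *-congʳ (*-congʳ (≈-trans (U-suc n) (*-congˡ (+-congˡ (-‿cong (p^-x^ (suc n))))))) ⟩
      U n ⊗ (1# ⊖ y ⊗ y) ⊗ (w′ ⊗ w′) ⊗ (1# ⊖ y)
        ≈⟨ solve 3 (λ v w y → v :* (con 1ℤ :- y :* y) :* (w :* w) :* (con 1ℤ :- y) :=
             v :* (((con 1ℤ :- y) :* w) :* ((con 1ℤ :- y) :* w)) :* (con 1ℤ :+ y)) ≈-refl (U n) w′ y ⟩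
      U n ⊗ (((1# ⊖ y) ⊗ w′) ⊗ ((1# ⊖ y) ⊗ w′)) ⊗ (1# ⊕ y)
        ≈⟨ *-congʳ (*-congˡ (*-cong (w-suc n) (w-suc n))) ⟨
      A n ⊗ (1# ⊕ y) ∎
      where
      y = x^ (suc n)
      w′ = w (suc n)

    Φ : ℕ → ℕ → C
    Φ d l = ∑ l (λ n → q^ (d *ℕ n) ⊗ A n)

    -- (1 - z) Φ(z) = (1 + x z) Φ(x z) for the series Φ(z) = Σ A n z^n, truncated after l terms, at z = q^d.
    Φ-step : ∀ d l → (1# ⊖ q^ d) ⊗ Φ d l ⊕ q^ (d *ℕ l) ⊗ ((1# ⊖ x^ l) ⊗ A l) ≈ (1# ⊕ q^ (2 +ℕ d)) ⊗ Φ (2 +ℕ d) l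
    Φ-step d zero = begin
      (1# ⊖ q^ d) ⊗ 0# ⊕ e ⊗ ((1# ⊖ x^ 0) ⊗ A 0)  ≈⟨ +-congˡ (*-congˡ (*-congʳ (+-congˡ (-‿cong q^-zero)))) ⟩
      (1# ⊖ q^ d) ⊗ 0# ⊕ e ⊗ ((1# ⊖ 1#) ⊗ A 0)
        ≈⟨ solve 4 (λ t e a s → (con 1ℤ :- t) :* con 0ℤ :+ e :* ((con 1ℤ :- con 1ℤ) :* a) := s :* con 0ℤ) ≈-refl
             (q^ d) e (A 0) (1# ⊕ q^ (2 +ℕ d)) ⟩
      (1# ⊕ q^ (2 +ℕ d)) ⊗ 0#                     ∎
      where e = q^ (d *ℕ 0)
    Φ-step d (suc l) = begin
      (1# ⊖ z) ⊗ (Φ d l ⊕ t ⊗ A l) ⊕ q^ (d *ℕ suc l) ⊗ ((1# ⊖ y) ⊗ A (suc l))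
        ≈⟨ +-congˡ (*-cong (≈-trans (≈-reflexive (cong q^ (ℕₚ.*-suc d l))) (q^-+ d (d *ℕ l)))
             (≈-trans (*-comm _ _) (A-suc l))) ⟩
      (1# ⊖ z) ⊗ (Φ d l ⊕ t ⊗ A l) ⊕ (z ⊗ t) ⊗ (A l ⊗ (1# ⊕ y))
        ≈⟨ +-congˡ (*-congˡ (*-congˡ (+-congˡ (x^-+ 1 l)))) ⟩
      (1# ⊖ z) ⊗ (Φ d l ⊕ t ⊗ A l) ⊕ (z ⊗ t) ⊗ (A l ⊗ (1# ⊕ x ⊗ y′))
        ≈⟨ solve 6 (λ z f t a x y →
             (con 1ℤ :- z) :* (f :+ t :* a) :+ (z :* t) :* (a :* (con 1ℤ :+ x :* y)) :=
             ((con 1ℤ :- z) :* f :+ t :* ((con 1ℤ :- y) :* a)) :+ (con 1ℤ :+ x :* z) :* (y :* t :* a)) ≈-refl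
             z (Φ d l) t (A l) x y′ ⟩
      ((1# ⊖ z) ⊗ Φ d l ⊕ t ⊗ ((1# ⊖ y′) ⊗ A l)) ⊕ (1# ⊕ x ⊗ z) ⊗ (y′ ⊗ t ⊗ A l)
        ≈⟨ +-cong (Φ-step d l) (*-cong (+-congˡ (≈-sym (q^-+ 2 d))) (*-congʳ (≈-sym
             (≈-trans (≈-reflexive (cong q^ (ℕₚ.*-distribʳ-+ l 2 d))) (q^-+ (2 *ℕ l) (d *ℕ l)))))) ⟩
      (1# ⊕ q^ (2 +ℕ d)) ⊗ Φ (2 +ℕ d) l ⊕ (1# ⊕ q^ (2 +ℕ d)) ⊗ (q^ ((2 +ℕ d) *ℕ l) ⊗ A l)
        ≈⟨ distribˡ _ _ _ ⟨
      (1# ⊕ q^ (2 +ℕ d)) ⊗ Φ (2 +ℕ d) (suc l) ∎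
      where
      x = x^ 1
      y = x^ (suc l)
      y′ = x^ l
      z = q^ d
      t = q^ (d *ℕ l)

    -- From q-integers and q-factorials to Pochhammer symbols

    module QFactorial
      (qInt : ℕ → ℕ → C) (qInt-zero : ∀ d → qInt d 0 ≈ 0#) (qInt-suc : ∀ d m → qInt d (suc m) ≈ qInt d m ⊕ q^ (d *ℕ m))
      (F : ℕ → C) (F-zero : F 0 ≈ 1#) (F-suc : ∀ m → F (suc m) ≈ F m ⊗ qInt 4 (suc m))
      where

      geometric : ∀ d n → (1# ⊖ q^ d) ⊗ qInt d n ≈ 1# ⊖ q^ (d *ℕ n)
      geometric d zero = begin
        (1# ⊖ q^ d) ⊗ qInt d 0  ≈⟨ *-congˡ (qInt-zero d) ⟩
        (1# ⊖ q^ d) ⊗ 0#        ≈⟨ solve 1 (λ t → (con 1ℤ :- t) :* con 0ℤ := con 1ℤ :- con 1ℤ) ≈-refl (q^ d) ⟩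
        1# ⊖ 1#                 ≈⟨ +-congˡ (-‿cong q^-zero) ⟨
        1# ⊖ q^ 0               ≡⟨ cong (λ i → 1# ⊖ q^ i) (ℕₚ.*-zeroʳ d) ⟨
        1# ⊖ q^ (d *ℕ 0)        ∎
      geometric d (suc n) = begin
        (1# ⊖ q^ d) ⊗ qInt d (suc n)                          ≈⟨ *-congˡ (qInt-suc d n) ⟩
        (1# ⊖ q^ d) ⊗ (qInt d n ⊕ q^ (d *ℕ n))                ≈⟨ distribˡ _ _ _ ⟩
        (1# ⊖ q^ d) ⊗ qInt d n ⊕ (1# ⊖ q^ d) ⊗ q^ (d *ℕ n)    ≈⟨ +-congʳ (geometric d n) ⟩
        (1# ⊖ q^ (d *ℕ n)) ⊕ (1# ⊖ q^ d) ⊗ q^ (d *ℕ n)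
          ≈⟨ solve 2 (λ t s → (con 1ℤ :- t) :+ (con 1ℤ :- s) :* t := con 1ℤ :- s :* t) ≈-refl (q^ (d *ℕ n)) (q^ d) ⟩
        1# ⊖ q^ d ⊗ q^ (d *ℕ n)                               ≈⟨ +-congˡ (-‿cong (q^-+ d (d *ℕ n))) ⟨
        1# ⊖ q^ (d +ℕ d *ℕ n)                                 ≡⟨ cong (λ i → 1# ⊖ q^ i) (ℕₚ.*-suc d n) ⟨
        1# ⊖ q^ (d *ℕ suc n)                                  ∎

      U-factorial : ∀ n → (1# ⊖ q^ 4) ^ n ⊗ F n ≈ U n
      U-factorial zero    = ≈-trans (*-identityˡ _) (≈-trans F-zero (≈-sym U-zero))
      U-factorial (suc n) = begin
        (1# ⊖ q^ 4) ⊗ (1# ⊖ q^ 4) ^ n ⊗ F (suc n)                   ≈⟨ *-congˡ (F-suc n) ⟩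
        (1# ⊖ q^ 4) ⊗ (1# ⊖ q^ 4) ^ n ⊗ (F n ⊗ qInt 4 (suc n))
          ≈⟨ solve 4 (λ r s f i → r :* s :* (f :* i) := s :* f :* (r :* i)) ≈-refl
               (1# ⊖ q^ 4) ((1# ⊖ q^ 4) ^ n) (F n) (qInt 4 (suc n)) ⟩
        (1# ⊖ q^ 4) ^ n ⊗ F n ⊗ ((1# ⊖ q^ 4) ⊗ qInt 4 (suc n))      ≈⟨ *-cong (U-factorial n) (geometric 4 (suc n)) ⟩
        U n ⊗ (1# ⊖ p^ (suc n))                                     ≈⟨ U-suc n ⟨
        U (suc n)                                                   ∎

      -- The denominator [n+1] completes [n]! to [n+1]!. Numerator and denominator then contain n +
      -- k + 1 brackets each, so the powers of 1 - p cancel when every bracket is replaced by its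
      -- factor 1 - p^m. The elements i and f stand for the two inverses in the definition of the
      -- q-Yamanouchi number.
      yamanouchi : ∀ n k j i f → qInt 4 (suc n) ⊗ i ≈ 1# → F n ⊗ F k ⊗ f ≈ 1# →
        qInt 4 (suc j) ⊗ i ⊗ (F (n +ℕ k) ⊗ f) ≈ (1# ⊖ p^ (suc j)) ⊗ U (n +ℕ k) ⊗ (u k ⊗ u (suc n))
      yamanouchi n k j i f i-inverse f-inverse = cancel-unit Un⁺Uk-inverse (begin
        U (suc n) ⊗ U k ⊗ (J ⊗ i ⊗ (F (n +ℕ k) ⊗ f))
          ≈⟨ *-congʳ (*-cong (≈-trans (U-suc n) (*-cong (≈-sym (U-factorial n)) (≈-sym (geometric 4 (suc n)))))
               (≈-sym (U-factorial k))) ⟩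
        (r ^ n ⊗ F n ⊗ (r ⊗ N)) ⊗ (r ^ k ⊗ F k) ⊗ (J ⊗ i ⊗ (F (n +ℕ k) ⊗ f))
          ≈⟨ solve 10 (λ rn Fn r N rk Fk J i Fnk f →
               (rn :* Fn :* (r :* N)) :* (rk :* Fk) :* (J :* i :* (Fnk :* f)) :=
               (r :* J) :* (rn :* rk :* Fnk) :* ((N :* i) :* (Fn :* Fk :* f))) ≈-refl
               (r ^ n) (F n) r N (r ^ k) (F k) J i (F (n +ℕ k)) f ⟩
        (r ⊗ J) ⊗ (r ^ n ⊗ r ^ k ⊗ F (n +ℕ k)) ⊗ ((N ⊗ i) ⊗ (F n ⊗ F k ⊗ f))
          ≈⟨ *-cong (*-cong (geometric 4 (suc j)) (≈-trans (*-congʳ (≈-sym (^-homo-* r n k))) (U-factorial (n +ℕ k))))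
               (*-cong i-inverse f-inverse) ⟩
        (1# ⊖ p^ (suc j)) ⊗ U (n +ℕ k) ⊗ (1# ⊗ 1#)
          ≈⟨ *-congˡ (*-cong (U-inverse (suc n)) (U-inverse k)) ⟨
        (1# ⊖ p^ (suc j)) ⊗ U (n +ℕ k) ⊗ ((U (suc n) ⊗ u (suc n)) ⊗ (U k ⊗ u k))
          ≈⟨ solve 6 (λ e Unk Un un Uk uk → e :* Unk :* ((Un :* un) :* (Uk :* uk)) :=
               Un :* Uk :* (e :* Unk :* (uk :* un))) ≈-refl
               (1# ⊖ p^ (suc j)) (U (n +ℕ k)) (U (suc n)) (u (suc n)) (U k) (u k) ⟩
        U (suc n) ⊗ U k ⊗ ((1# ⊖ p^ (suc j)) ⊗ U (n +ℕ k) ⊗ (u k ⊗ u (suc n))) ∎)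
        where
        r = 1# ⊖ q^ 4
        N = qInt 4 (suc n)
        J = qInt 4 (suc j)
        Un⁺Uk-inverse : U (suc n) ⊗ U k ⊗ (u (suc n) ⊗ u k) ≈ 1#
        Un⁺Uk-inverse = ≈-trans
          (solve 4 (λ a b c d → a :* b :* (c :* d) := (a :* c) :* (b :* d)) ≈-refl (U (suc n)) (U k) (u (suc n)) (u k))
          (≈-trans (*-cong (U-inverse (suc n)) (U-inverse k)) (*-identityˡ 1#))

      -- Since 1 - x = (1 + q) (1 - q), clearing the denominator with 1 - x instead of 1 - q leaves
      -- the extra 1 + q that later starts the product (-q;q²).
      qInt-even : ∀ j → (1# ⊖ x^ 1) ⊗ qInt 1 (2 *ℕ j +ℕ 2) ≈ (1# ⊕ q^ 1) ⊗ (1# ⊖ x^ (suc j))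
      qInt-even j = begin
        (1# ⊖ q^ 2) ⊗ I
          ≈⟨ *-congʳ (+-congˡ (-‿cong (q^-+ 1 1))) ⟩
        (1# ⊖ q^ 1 ⊗ q^ 1) ⊗ I
          ≈⟨ solve 2 (λ s i → (con 1ℤ :- s :* s) :* i := (con 1ℤ :+ s) :* ((con 1ℤ :- s) :* i)) ≈-refl (q^ 1) I ⟩
        (1# ⊕ q^ 1) ⊗ ((1# ⊖ q^ 1) ⊗ I)
          ≈⟨ *-congˡ (geometric 1 (2 *ℕ j +ℕ 2)) ⟩
        (1# ⊕ q^ 1) ⊗ (1# ⊖ q^ (1 *ℕ (2 *ℕ j +ℕ 2)))
          ≡⟨ cong (λ i → (1# ⊕ q^ 1) ⊗ (1# ⊖ q^ i)) (even-exponent j) ⟩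
        (1# ⊕ q^ 1) ⊗ (1# ⊖ x^ (suc j)) ∎
        where
        I = qInt 1 (2 *ℕ j +ℕ 2)

      -- The sum of one group of summands

      module Summation
        (s : ℕ → ℕ → C)
        (s-value : ∀ k j → s k j ≈
          q^ (2 *ℕ k +ℕ j *ℕ j) ⊗ ((1# ⊖ p^ (suc j)) ⊗ U (k +ℕ j +ℕ k) ⊗ (u k ⊗ u (suc (k +ℕ j))))
            ⊗ w (k +ℕ (k +ℕ j)) ⊗ qInt 1 (2 *ℕ j +ℕ 2))
        where

        -- The part of a summand, once multiplied by 1 - x, that depends only on its group n = 2k +
        -- j.
        weight : ℕ → C
        weight n = (1# ⊕ q^ 1) ⊗ (q^ n ⊗ (U n ⊗ w n))

        s-ψ : ∀ k j → (1# ⊖ x^ 1) ⊗ s k j ≈ weight (k +ℕ (k +ℕ j)) ⊗ ψ k (suc (k +ℕ j))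
        s-ψ k j = begin
          (1# ⊖ x^ 1) ⊗ s k j
            ≈⟨ *-congˡ (s-value k j) ⟩
          (1# ⊖ x^ 1) ⊗ (q^ (2 *ℕ k +ℕ j *ℕ j) ⊗ (e ⊗ U (k +ℕ j +ℕ k) ⊗ v) ⊗ w n ⊗ I)
            ≈⟨ *-congˡ (*-congʳ (*-congʳ (*-cong
                 (≈-trans (≈-reflexive (cong q^ (summand-exponent k j))) (q^-+ n (2 *ℕ triangle j)))
                 (*-congʳ (*-congˡ (≈-reflexive (cong U (ℕₚ.+-comm (k +ℕ j) k)))))))) ⟩
          (1# ⊖ x^ 1) ⊗ ((q^ n ⊗ x^ (triangle j)) ⊗ (e ⊗ U n ⊗ v) ⊗ w n ⊗ I)
            ≈⟨ solve 8 (λ o Q T e Un v wn I → o :* ((Q :* T) :* (e :* Un :* v) :* wn :* I) :=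
                 (o :* I) :* (Q :* (Un :* wn)) :* (T :* e :* v)) ≈-refl
                 (1# ⊖ x^ 1) (q^ n) (x^ (triangle j)) e (U n) v (w n) I ⟩
          ((1# ⊖ x^ 1) ⊗ I) ⊗ (q^ n ⊗ (U n ⊗ w n)) ⊗ (x^ (triangle j) ⊗ e ⊗ v)
            ≈⟨ *-congʳ (*-congʳ (qInt-even j)) ⟩
          (1# ⊕ q^ 1) ⊗ (1# ⊖ x^ (suc j)) ⊗ (q^ n ⊗ (U n ⊗ w n)) ⊗ (x^ (triangle j) ⊗ e ⊗ v)
            ≈⟨ solve 6 (λ a b c T e v → a :* b :* c :* (T :* e :* v) := (a :* c) :* (T :* b :* e :* v)) ≈-refl
                 (1# ⊕ q^ 1) (1# ⊖ x^ (suc j)) (q^ n ⊗ (U n ⊗ w n)) (x^ (triangle j)) e v ⟩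
          weight n ⊗ (x^ (triangle j) ⊗ (1# ⊖ x^ (suc j)) ⊗ e ⊗ v)
            ≈⟨ *-congˡ (ψ-upper k j) ⟨
          weight n ⊗ ψ k (suc (k +ℕ j)) ∎
          where
          n = k +ℕ (k +ℕ j)
          e = 1# ⊖ p^ (suc j)
          v = u k ⊗ u (suc (k +ℕ j))
          I = qInt 1 (2 *ℕ j +ℕ 2)

        -- The factor 1 - x needed by `s-ψ` reappears in the value found by `halfConv-ψ`, so it
        -- cancels as a unit. The two factors w n, one from the weight and one from that value, make
        -- up the square in `A n`.
        halfConv-s : ∀ d → (1# ⊖ x^ 1) ⊗ d ≈ 1# → ∀ n →
          let b = (1# ⊕ q^ 1) ⊗ (q^ n ⊗ A n) in halfConv n s ⊕ halfConv n s ≈ b ⊕ b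
        halfConv-s d d-inverse n = cancel-unit d-inverse (begin
          o ⊗ (halfConv n s ⊕ halfConv n s)                  ≈⟨ distribˡ o _ _ ⟩
          o ⊗ halfConv n s ⊕ o ⊗ halfConv n s                ≈⟨ +-cong value value ⟩
          weight n ⊗ half ⊕ weight n ⊗ half                  ≈⟨ distribˡ _ _ _ ⟨
          weight n ⊗ (half ⊕ half)                           ≈⟨ *-congˡ (halfConv-ψ n) ⟩
          weight n ⊗ (o ⊗ w n ⊕ o ⊗ w n)
            ≈⟨ solve 5 (λ c o Q U w → (c :* (Q :* (U :* w))) :* (o :* w :+ o :* w) :=
                 o :* (c :* (Q :* (U :* (w :* w))) :+ c :* (Q :* (U :* (w :* w))))) ≈-refl
                 (1# ⊕ q^ 1) o (q^ n) (U n) (w n) ⟩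
          o ⊗ (b ⊕ b)                                        ∎)
          where
          o = 1# ⊖ x^ 1
          b = (1# ⊕ q^ 1) ⊗ (q^ n ⊗ A n)
          half = halfConv n (λ k j → ψ k (suc (k +ℕ j)))
          value : o ⊗ halfConv n s ≈ weight n ⊗ half
          value = begin
            o ⊗ halfConv n s                                           ≈⟨ halfConv-distribˡ o n s ⟩
            halfConv n (λ k j → o ⊗ s k j)
              ≈⟨ halfConv-cong n (λ k j e → ≈-trans (s-ψ k j) (*-congʳ (≈-reflexive (cong weight e)))) ⟩
            halfConv n (λ k j → weight n ⊗ ψ k (suc (k +ℕ j)))         ≈⟨ halfConv-distribˡ _ n _ ⟨
            weight n ⊗ half                                            ∎

-- Monomials, orders and inverses of power series

mono-*ₚ-suc : ∀ k f n → (mono (suc k) *ₚ f) (suc n) ≡ (mono k *ₚ f) n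
mono-*ₚ-suc k f n = trans (*ₚ-suc (mono (suc k)) f n)
  (trans (cong (_+ (mono k *ₚ f) n) (ℤₚ.*-zeroˡ (f (suc n)))) (ℤₚ.+-identityˡ _))

mono-+-coefficient : ∀ m n → mono (m +ℕ n) ≈ₚ mono m *ₚ mono n
mono-+-coefficient zero    n i       = sym (oneₚ-*ₚ (mono n) i)
mono-+-coefficient (suc m) n zero    = sym (trans (ℤₚ.+-identityˡ _) (ℤₚ.*-zeroˡ (mono n 0)))
mono-+-coefficient (suc m) n (suc i) = trans (mono-+-coefficient m n i) (sym (mono-*ₚ-suc m (mono n) i))

mono-*ₚ-low : ∀ {n k} f → n < k → (mono k *ₚ f) n ≡ 0ℤ
mono-*ₚ-low {zero}  {suc k} f n<k       = trans (ℤₚ.+-identityˡ _) (ℤₚ.*-zeroˡ (f 0))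
mono-*ₚ-low {suc n} {suc k} f (s≤s n<k) = trans (mono-*ₚ-suc k f n) (mono-*ₚ-low f n<k)

mono-low : ∀ {n k} → n < k → mono k n ≡ 0ℤ
mono-low {n} {k} n<k = trans (sym (*ₚ-oneₚ (mono k) n)) (mono-*ₚ-low oneₚ n<k)

powₚ-low : ∀ g → g 0 ≡ 0ℤ → ∀ k n → n < k → powₚ g k n ≡ 0ℤ
powₚ-low g g₀≡0 (suc k) n (s≤s n≤k) = sumℤ-zero (suc n) _ vanish
  where
  vanish : ∀ i → i < suc n → powₚ g k i * g (n ∸ i) ≡ 0ℤ
  vanish i (s≤s i≤n) with ℕₚ.m≤n⇒m<n∨m≡n i≤n
  ... | inj₁ i<n  = trans (cong (_* g (n ∸ i)) (powₚ-low g g₀≡0 k i (ℕₚ.<-≤-trans i<n n≤k))) (ℤₚ.*-zeroˡ (g (n ∸ i)))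
  ... | inj₂ refl = trans (cong (powₚ g k i *_) (trans (cong g (ℕₚ.n∸n≡0 i)) g₀≡0)) (ℤₚ.*-zeroʳ (powₚ g k i))

-- The partial sums S m of Σ (1 - f)^k satisfy f S m + (1 - f)^m = 1.
*ₚ-invₚ : ∀ f → f 0 ≡ 1ℤ → f *ₚ invₚ f ≋ oneₚ
*ₚ-invₚ f f₀≡1 = coefficientwise λ n → begin
  (f *ₚ invₚ f) n
    ≡⟨ *ₚ-congₙ {f} {f} {invₚ f} {S (suc n)} n (λ _ _ → refl) (truncate n) ⟩
  (f *ₚ S (suc n)) n
    ≡⟨ ℤₚ.+-identityʳ _ ⟨
  (f *ₚ S (suc n)) n + 0ℤ
    ≡⟨ cong (λ z → (f *ₚ S (suc n)) n + z) (powₚ-low g g₀≡0 (suc n) n ℕₚ.≤-refl) ⟨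
  (f *ₚ S (suc n)) n + powₚ g (suc n) n
    ≡⟨ telescope (suc n) n ⟩
  oneₚ n ∎
  where
  open ≡-Reasoning
  g : PS
  g = oneₚ -ₚ f
  g₀≡0 : g 0 ≡ 0ℤ
  g₀≡0 = cong (λ z → 1ℤ - z) f₀≡1
  S : ℕ → PS
  S m = sumₚ m (powₚ g)
  truncate : ∀ n i → i ≤ n → invₚ f i ≡ S (suc n) i
  truncate n i i≤n = sym (sumℤ-extend (λ k → powₚ g k i) (s≤s i≤n) (λ k → powₚ-low g g₀≡0 k i))
  f+g≈1 : f +ₚ g ≈ₚ oneₚ
  f+g≈1 i = trans (cong (λ z → f i + z) (ℤₚ.+-comm (oneₚ i) (- f i)))
    (trans (sym (ℤₚ.+-assoc (f i) (- f i) (oneₚ i)))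
      (trans (cong (_+ oneₚ i) (ℤₚ.+-inverseʳ (f i))) (ℤₚ.+-identityˡ (oneₚ i))))
  telescope : ∀ m → f *ₚ S m +ₚ powₚ g m ≈ₚ oneₚ
  telescope zero    i = trans (cong (_+ oneₚ i) (trans (*ₚ-comm f zeroₚ i) (zeroₚ-*ₚ f i))) (ℤₚ.+-identityˡ (oneₚ i))
  telescope (suc m) i = begin
    (f *ₚ (S m +ₚ P)) i + (P *ₚ g) i                ≡⟨ cong (_+ (P *ₚ g) i) (*ₚ-distribˡ f (S m) P i) ⟩
    (f *ₚ S m) i + (f *ₚ P) i + (P *ₚ g) i          ≡⟨ ℤₚ.+-assoc ((f *ₚ S m) i) _ _ ⟩
    (f *ₚ S m) i + ((f *ₚ P) i + (P *ₚ g) i)        ≡⟨ cong (λ z → (f *ₚ S m) i + (z + (P *ₚ g) i)) (*ₚ-comm f P i) ⟩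
    (f *ₚ S m) i + ((P *ₚ f) i + (P *ₚ g) i)        ≡⟨ cong ((f *ₚ S m) i +_) (*ₚ-distribˡ P f g i) ⟨
    (f *ₚ S m) i + (P *ₚ (f +ₚ g)) i                ≡⟨ cong ((f *ₚ S m) i +_) (*ₚ-cong {P} {P} {f +ₚ g} {oneₚ} (λ _ → refl) f+g≈1 i) ⟩
    (f *ₚ S m) i + (P *ₚ oneₚ) i                    ≡⟨ cong ((f *ₚ S m) i +_) (*ₚ-oneₚ P i) ⟩
    (f *ₚ S m) i + P i                              ≡⟨ telescope m i ⟩
    oneₚ i                                          ∎
    where P = powₚ g m

*ₚ-constant : ∀ f g → f 0 ≡ 1ℤ → g 0 ≡ 1ℤ → (f *ₚ g) 0 ≡ 1ℤ
*ₚ-constant f g f₀≡1 g₀≡1 = trans (ℤₚ.+-identityˡ _) (cong₂ _*_ f₀≡1 g₀≡1)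

poch-constant : ∀ c e d n → poch c (suc e) d n 0 ≡ 1ℤ
poch-constant c e d zero    = refl
poch-constant c e d (suc n) = *ₚ-constant (poch c (suc e) d n) (pochFactor c (suc e) d n)
  (poch-constant c e d n) (cong (λ z → 1ℤ - z) (ℤₚ.*-zeroʳ c))

qint-constant : ∀ d m → qint (suc d) (suc m) 0 ≡ 1ℤ
qint-constant d zero    = cong (λ i → 0ℤ + mono i 0) (ℕₚ.*-zeroʳ d)
qint-constant d (suc m) = trans (ℤₚ.+-identityʳ _) (qint-constant d m)

qfact-constant : ∀ d m → qfact (suc d) m 0 ≡ 1ℤ
qfact-constant d zero    = refl
qfact-constant d (suc m) = *ₚ-constant (qfact (suc d) m) (qint (suc d) (suc m))
  (qfact-constant d m) (qint-constant d m)

-- Specialisation of the abstract identities to power series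

open CommutativeRing PSRing using (setoid; *-congˡ; *-congʳ; *-assoc; *-comm; *-identityˡ; +-identityˡ)
  renaming (refl to ≋-refl; trans to ≋-trans)
open CommutativeSemigroupProperties (CommutativeRing.*-commutativeSemigroup PSRing) using (xy∙z≈xz∙y)
open FiniteSums PSRing
open QSeries PSRing constants mono ≋-refl (λ m n → coefficientwise (mono-+-coefficient m n))

poch-one-suc : ∀ d n → poch 1ℤ d d (suc n) ≋ poch 1ℤ d d n *ₚ (oneₚ -ₚ mono (d *ℕ suc n))
poch-one-suc d n = *-congˡ {poch 1ℤ d d n} (coefficientwise λ i →
  cong (λ z → oneₚ i - z) (trans (ℤₚ.*-identityˡ _) (cong (λ k → mono k i) (sym (ℕₚ.*-suc d n)))))

u w : ℕ → PS
u n = invₚ (poch 1ℤ 4 4 n)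
w n = invₚ (poch 1ℤ 2 2 n)

open Pochhammer (poch 1ℤ 4 4) u (poch 1ℤ 2 2) w
  ≋-refl (poch-one-suc 4) (λ n → *ₚ-invₚ (poch 1ℤ 4 4 n) (poch-constant 1ℤ 3 4 n))
  ≋-refl (poch-one-suc 2) (λ n → *ₚ-invₚ (poch 1ℤ 2 2 n) (poch-constant 1ℤ 1 2 n))
open QFactorial qint (λ _ → ≋-refl) (λ _ _ → ≋-refl) (qfact 4) ≋-refl (λ _ → ≋-refl)

qYam-value : ∀ k j → qYam 4 (k +ℕ j) k ≋
  (oneₚ -ₚ mono (4 *ℕ suc j)) *ₚ poch 1ℤ 4 4 (k +ℕ j +ℕ k) *ₚ (u k *ₚ u (suc (k +ℕ j)))
-- Both truncated differences resolve: n - k = j in the bracket, and (n + k) - n = k in the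
-- q-binomial.
qYam-value k j rewrite ℕₚ.m+n∸m≡n k j | ℕₚ.m+n∸m≡n (k +ℕ j) k =
  yamanouchi (k +ℕ j) k j (invₚ (qint 4 (suc (k +ℕ j)))) (invₚ (qfact 4 (k +ℕ j) *ₚ qfact 4 k))
    (*ₚ-invₚ (qint 4 (suc (k +ℕ j))) (qint-constant 3 (k +ℕ j)))
    (*ₚ-invₚ (qfact 4 (k +ℕ j) *ₚ qfact 4 k)
      (*ₚ-constant (qfact 4 (k +ℕ j)) (qfact 4 k) (qfact-constant 3 (k +ℕ j)) (qfact-constant 3 k)))

open Summation summand (λ k j → *-congʳ {qint 1 (2 *ℕ j +ℕ 2)} (*-congʳ {w (k +ℕ (k +ℕ j))}
  (*-congˡ {mono (2 *ℕ k +ℕ j *ℕ j)} (qYam-value k j))))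

double-injective : ∀ {a b} → a + a ≡ b + b → a ≡ b
double-injective {a} {b} a+a≡b+b = ℤₚ.*-cancelˡ-≡ (1ℤ + 1ℤ) a b (trans (double a) (trans a+a≡b+b (sym (double b))))
  where
  double : ∀ c → (1ℤ + 1ℤ) * c ≡ c + c
  double c = trans (ℤₚ.*-distribʳ-+ c 1ℤ 1ℤ) (cong₂ _+_ (ℤₚ.*-identityˡ c) (ℤₚ.*-identityˡ c))

-- The factor 2 disappears here: the integers have no 2-torsion, so a doubled identity of series can
-- be halved coefficient by coefficient.
halfConv-summand : ∀ n → halfConv n summand ≋ (oneₚ +ₚ mono 1) *ₚ (mono n *ₚ A n)
halfConv-summand n = coefficientwise λ i →
  double-injective (coefficient (halfConv-s (invₚ (oneₚ -ₚ mono 2)) (*ₚ-invₚ (oneₚ -ₚ mono 2) refl) n) i)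

-- N is included: this is congruence modulo q^(N+1).
infix 4 _≋[_]_
record _≋[_]_ (f : PS) (N : ℕ) (g : PS) : Set where
  constructor upTo
  field agree : ∀ n → n ≤ N → f n ≡ g n

open _≋[_]_

congruence : ℕ → Setoid 0ℓ 0ℓ
congruence N = record
  { Carrier = PS
  ; _≈_ = λ f g → f ≋[ N ] g
  ; isEquivalence = record
    { refl  = upTo (λ _ _ → refl)
    ; sym   = λ e → upTo (λ n n≤N → sym (agree e n n≤N))
    ; trans = λ d e → upTo (λ n n≤N → trans (agree d n n≤N) (agree e n n≤N)) } }

≋⇒≋[] : ∀ {f g N} → f ≋ g → f ≋[ N ] g
≋⇒≋[] e = upTo (λ n _ → coefficient e n)

*ₚ-congˡ-mod : ∀ f {g h N} → g ≋[ N ] h → f *ₚ g ≋[ N ] f *ₚ h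
*ₚ-congˡ-mod f {g} {h} g≋h = upTo λ n n≤N →
  *ₚ-congₙ {f} {f} {g} {h} n (λ _ _ → refl) (λ i i≤n → agree g≋h i (ℕₚ.≤-trans i≤n n≤N))

*ₚ-congʳ-mod : ∀ f {g h N} → g ≋[ N ] h → g *ₚ f ≋[ N ] h *ₚ f
*ₚ-congʳ-mod f {g} {h} g≋h = upTo λ n n≤N →
  *ₚ-congₙ {g} {h} {f} {f} n (λ i i≤n → agree g≋h i (ℕₚ.≤-trans i≤n n≤N)) (λ _ _ → refl)

+ₚ-mono-mod : ∀ f g {N k} → N < k → f +ₚ mono k *ₚ g ≋[ N ] f
+ₚ-mono-mod f g {N} {k} N<k = upTo λ n n≤N → trans
  (cong (λ z → f n + z) (mono-*ₚ-low {n} {k} g (ℕₚ.≤-<-trans n≤N N<k))) (ℤₚ.+-identityʳ (f n))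

-- The product side modulo powers of q

pochFactor-minus : ∀ j → pochFactor 1ℤ 1 2 j ≋ oneₚ -ₚ mono (1 +ℕ 2 *ℕ j)
pochFactor-minus j = coefficientwise λ n → cong (λ z → oneₚ n - z) (ℤₚ.*-identityˡ (mono (1 +ℕ 2 *ℕ j) n))

pochFactor-plus : ∀ j → pochFactor -1ℤ 1 2 j ≋ oneₚ +ₚ mono (1 +ℕ 2 *ℕ j)
pochFactor-plus j = coefficientwise λ n → cong (λ z → oneₚ n + z)
  (trans (cong -_ (ℤₚ.-1*i≡-i (mono (1 +ℕ 2 *ℕ j) n))) (ℤₚ.neg-involutive _))

poch-stable : ∀ c N → poch c 1 2 (suc N) ≋[ N ] poch c 1 2 N
poch-stable c N = begin
  poch c 1 2 N *ₚ pochFactor c 1 2 N  ≈⟨ *ₚ-congˡ-mod (poch c 1 2 N) factor ⟩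
  poch c 1 2 N *ₚ oneₚ                ≈⟨ upTo (λ n _ → *ₚ-oneₚ (poch c 1 2 N) n) ⟩
  poch c 1 2 N                        ∎
  where
  open SetoidReasoning (congruence N)
  factor : pochFactor c 1 2 N ≋[ N ] oneₚ
  factor = upTo λ n n≤N → trans
    (cong (λ z → oneₚ n - c * z) (mono-low (ℕₚ.≤-<-trans n≤N (s≤s (ℕₚ.m≤n*m N 2)))))
    (trans (cong (λ z → oneₚ n - z) (ℤₚ.*-zeroʳ c)) (ℤₚ.+-identityʳ (oneₚ n)))

pochInf-poch : ∀ c N → pochInf c 1 2 ≋[ N ] poch c 1 2 (suc N)
pochInf-poch c N = upTo (go N)
  where
  go : ∀ N n → n ≤ N → poch c 1 2 (suc n) n ≡ poch c 1 2 (suc N) n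
  go N n n≤N with ℕₚ.m≤n⇒m<n∨m≡n n≤N
  go N       n n≤N | inj₂ refl      = refl
  go (suc N) n n≤N | inj₁ (s≤s n≤N′) = trans (go N n n≤N′) (sym (agree (poch-stable c (suc N)) n n≤N))

-- At z = q^d with d > N, every term after the first has order at least d, and the first is A 0 = 1.
Φ-one : ∀ {N d} → N < d → ∀ l → Φ d (suc l) ≋[ N ] oneₚ
Φ-one {N} {d} N<d zero    = ≋⇒≋[] (begin
  zeroₚ +ₚ mono (d *ℕ 0) *ₚ A 0  ≈⟨ +-identityˡ (mono (d *ℕ 0) *ₚ A 0) ⟩
  mono (d *ℕ 0) *ₚ A 0           ≡⟨ cong (λ i → mono i *ₚ A 0) (ℕₚ.*-zeroʳ d) ⟩
  oneₚ *ₚ A 0                    ≈⟨ *-identityˡ (A 0) ⟩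
  A 0                            ≈⟨ A-zero ⟩
  oneₚ                           ∎)
  where open SetoidReasoning setoid
Φ-one {N} {d} N<d (suc l) = begin
  Φ d (suc l) +ₚ mono (d *ℕ suc l) *ₚ A (suc l)  ≈⟨ +ₚ-mono-mod (Φ d (suc l)) (A (suc l)) (ℕₚ.<-≤-trans N<d (ℕₚ.m≤m*n d (suc l))) ⟩
  Φ d (suc l)                                    ≈⟨ Φ-one N<d l ⟩
  oneₚ                                           ∎
  where open SetoidReasoning (congruence N)

-- Each application of the functional equation moves from z = q^d to q^(d+2), using up 1 - q^d and
-- producing 1 + q^(d+2). The plus factors are thus one step ahead of the minus factors, and the
-- prefactor 1 + q of the groups supplies the one missing at the start.
poch-Φ : ∀ N K → let X = (oneₚ +ₚ mono 1) *ₚ Φ 1 (suc N) in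
  poch 1ℤ 1 2 K *ₚ X ≋[ N ] poch -1ℤ 1 2 (suc K) *ₚ Φ (1 +ℕ 2 *ℕ K) (suc N)
poch-Φ N zero    = ≋⇒≋[] (begin
  oneₚ *ₚ ((oneₚ +ₚ mono 1) *ₚ Φ 1 (suc N))  ≈⟨ *-assoc oneₚ (oneₚ +ₚ mono 1) (Φ 1 (suc N)) ⟨
  oneₚ *ₚ (oneₚ +ₚ mono 1) *ₚ Φ 1 (suc N)    ≈⟨ *-congʳ {Φ 1 (suc N)} (*-congˡ {oneₚ} (pochFactor-plus 0)) ⟨
  poch -1ℤ 1 2 1 *ₚ Φ 1 (suc N)              ∎)
  where open SetoidReasoning setoid
poch-Φ N (suc K) = begin
  P *ₚ F *ₚ X
    ≈⟨ ≋⇒≋[] (xy∙z≈xz∙y P F X) ⟩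
  P *ₚ X *ₚ F
    ≈⟨ *ₚ-congʳ-mod F (poch-Φ N K) ⟩
  Q *ₚ Φ d L *ₚ F
    ≈⟨ ≋⇒≋[] (*-assoc Q (Φ d L) F) ⟩
  Q *ₚ (Φ d L *ₚ F)
    ≈⟨ ≋⇒≋[] (*-congˡ {Q} (*-comm (Φ d L) F)) ⟩
  Q *ₚ (F *ₚ Φ d L)
    ≈⟨ ≋⇒≋[] (*-congˡ {Q} (*-congʳ {Φ d L} (pochFactor-minus K))) ⟩
  Q *ₚ ((oneₚ -ₚ mono d) *ₚ Φ d L)
    -- The boundary term of the truncated equation has order at least dL ≥ L = N + 1, so it can be
    -- added freely modulo q^(N+1).
    ≈⟨ *ₚ-congˡ-mod Q (+ₚ-mono-mod ((oneₚ -ₚ mono d) *ₚ Φ d L) R (ℕₚ.m≤n*m L d)) ⟨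
  Q *ₚ ((oneₚ -ₚ mono d) *ₚ Φ d L +ₚ mono (d *ℕ L) *ₚ R)
    ≈⟨ ≋⇒≋[] (*-congˡ {Q} (Φ-step d L)) ⟩
  Q *ₚ ((oneₚ +ₚ mono (2 +ℕ d)) *ₚ Φ (2 +ℕ d) L)
    ≡⟨ cong (λ i → Q *ₚ ((oneₚ +ₚ mono i) *ₚ Φ i L)) (cong suc (sym (ℕₚ.*-suc 2 K))) ⟩
  Q *ₚ ((oneₚ +ₚ mono d′) *ₚ Φ d′ L)
    ≈⟨ ≋⇒≋[] (*-assoc Q (oneₚ +ₚ mono d′) (Φ d′ L)) ⟨
  Q *ₚ (oneₚ +ₚ mono d′) *ₚ Φ d′ L
    ≈⟨ ≋⇒≋[] (*-congʳ {Φ d′ L} (*-congˡ {Q} (pochFactor-plus (suc K)))) ⟨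
  poch -1ℤ 1 2 (suc (suc K)) *ₚ Φ d′ L ∎
  where
  open SetoidReasoning (congruence N)
  d d′ L : ℕ
  d = 1 +ℕ 2 *ℕ K
  d′ = 1 +ℕ 2 *ℕ suc K
  L = suc N
  P Q F X R : PS
  P = poch 1ℤ 1 2 K
  Q = poch -1ℤ 1 2 (suc K)
  F = pochFactor 1ℤ 1 2 K
  X = (oneₚ +ₚ mono 1) *ₚ Φ 1 L
  R = (oneₚ -ₚ mono (2 *ℕ L)) *ₚ A L

lhs-Φ : ∀ N → lhs ≋[ N ] (oneₚ +ₚ mono 1) *ₚ Φ 1 (suc N)
lhs-Φ N = begin
  pochInf -1ℤ 1 2 *ₚ I                   ≈⟨ *ₚ-congʳ-mod I (pochInf-poch -1ℤ N) ⟩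
  -- To end with N + 1 minus factors, `poch-Φ` is used at K = N + 1 and brings N + 2 plus factors;
  -- the surplus one, 1 + q^(2N+3), is 1 modulo q^(N+1).
  poch -1ℤ 1 2 (suc N) *ₚ I              ≈⟨ *ₚ-congʳ-mod I stable ⟨
  poch -1ℤ 1 2 (suc (suc N)) *ₚ I        ≈⟨ *ₚ-congʳ-mod I (upTo (λ n _ → *ₚ-oneₚ (poch -1ℤ 1 2 (suc (suc N))) n)) ⟨
  poch -1ℤ 1 2 (suc (suc N)) *ₚ oneₚ *ₚ I
    ≈⟨ *ₚ-congʳ-mod I (*ₚ-congˡ-mod (poch -1ℤ 1 2 (suc (suc N))) (Φ-one N<d N)) ⟨
  poch -1ℤ 1 2 (suc (suc N)) *ₚ Φ (1 +ℕ 2 *ℕ suc N) (suc N) *ₚ I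
                                         ≈⟨ *ₚ-congʳ-mod I (poch-Φ N (suc N)) ⟨
  -- The finite product goes back to the infinite one, because I inverts the latter.
  poch 1ℤ 1 2 (suc N) *ₚ X *ₚ I          ≈⟨ *ₚ-congʳ-mod I (*ₚ-congʳ-mod X (pochInf-poch 1ℤ N)) ⟨
  pochInf 1ℤ 1 2 *ₚ X *ₚ I               ≈⟨ ≋⇒≋[] (xy∙z≈xz∙y (pochInf 1ℤ 1 2) X I) ⟩
  pochInf 1ℤ 1 2 *ₚ I *ₚ X               ≈⟨ *ₚ-congʳ-mod X (≋⇒≋[] (*ₚ-invₚ (pochInf 1ℤ 1 2) refl)) ⟩
  oneₚ *ₚ X                              ≈⟨ ≋⇒≋[] (*-identityˡ X) ⟩
  X                                      ∎
  where
  open SetoidReasoning (congruence N)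
  I X : PS
  I = invₚ (pochInf 1ℤ 1 2)
  X = (oneₚ +ₚ mono 1) *ₚ Φ 1 (suc N)
  N<d : N < 1 +ℕ 2 *ℕ suc N
  N<d = s≤s (ℕₚ.≤-trans (ℕₚ.n≤1+n N) (ℕₚ.m≤n*m (suc N) 2))
  stable : poch -1ℤ 1 2 (suc (suc N)) ≋[ N ] poch -1ℤ 1 2 (suc N)
  stable = upTo λ n n≤N → agree (poch-stable -1ℤ (suc N)) n (ℕₚ.m≤n⇒m≤1+n n≤N)

-- The double sum

summand-low : ∀ N k j → N < k +ℕ (k +ℕ j) → summand k j N ≡ 0ℤ
summand-low N k j N<2k+j = trans (coefficient reassociate N) (mono-*ₚ-low (Y *ₚ (w n *ₚ I)) (ℕₚ.<-≤-trans N<2k+j exponent))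
  where
  open SetoidReasoning setoid
  n e : ℕ
  n = k +ℕ (k +ℕ j)
  e = 2 *ℕ k +ℕ j *ℕ j
  Y I : PS
  Y = qYam 4 (k +ℕ j) k
  I = qint 1 (2 *ℕ j +ℕ 2)
  reassociate : summand k j ≋ mono e *ₚ (Y *ₚ (w n *ₚ I))
  reassociate = ≋-trans (*-assoc (mono e *ₚ Y) (w n) I) (*-assoc (mono e) Y (w n *ₚ I))
  -- The excess of 2k + j² over the group number 2k + j is 2 (j choose 2), which is nonnegative.
  exponent : n ≤ e
  exponent = ℕₚ.≤-trans (ℕₚ.m≤m+n n (2 *ℕ triangle j)) (ℕₚ.≤-reflexive (sym (summand-exponent k j)))

∑-coefficient : ∀ n F i → ∑ n F i ≡ sumℤ n (λ m → F m i)
∑-coefficient zero    F i = refl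
∑-coefficient (suc n) F i = cong (_+ F n i) (∑-coefficient n F i)

halfConv-coefficient : ∀ n s i → halfConv n s i ≡ halfConvℤ n (λ k j → s k j i)
halfConv-coefficient zero          s i = refl
halfConv-coefficient (suc zero)    s i = refl
halfConv-coefficient (suc (suc n)) s i =
  cong (λ z → s 0 (suc (suc n)) i + z) (halfConv-coefficient n (λ k j → s (suc k) j) i)

rhs-Φ : ∀ N → rhs N ≡ ((oneₚ +ₚ mono 1) *ₚ Φ 1 (suc N)) N
rhs-Φ N = begin
  rhs N
    -- Within the square k, j ≤ N, terms of groups beyond N have no coefficient at q^N, so exactly
    -- the groups 0 to N remain, matching the N + 1 terms of the truncated Φ.
    ≡⟨ sumℤ-box N (λ k j → summand k j N) ℕₚ.≤-refl ℕₚ.≤-refl (summand-low N) ⟩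
  sumℤ (suc N) (λ m → halfConvℤ m (λ k j → summand k j N))
    ≡⟨ sumℤ-cong (suc N) (λ m _ → trans (sym (halfConv-coefficient m summand N)) (value m)) ⟩
  sumℤ (suc N) (λ m → (a *ₚ (mono (1 *ℕ m) *ₚ A m)) N)
    ≡⟨ ∑-coefficient (suc N) (λ m → a *ₚ (mono (1 *ℕ m) *ₚ A m)) N ⟨
  ∑ (suc N) (λ m → a *ₚ (mono (1 *ℕ m) *ₚ A m)) N
    ≡⟨ coefficient (∑-distribˡ a (suc N) (λ m → mono (1 *ℕ m) *ₚ A m)) N ⟨
  (a *ₚ Φ 1 (suc N)) N ∎
  where
  open ≡-Reasoning
  a : PS
  a = oneₚ +ₚ mono 1
  value : ∀ m → halfConv m summand N ≡ (a *ₚ (mono (1 *ℕ m) *ₚ A m)) N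
  value m = trans (coefficient (halfConv-summand m) N)
    (cong (λ i → (a *ₚ (mono i *ₚ A m)) N) (sym (ℕₚ.*-identityˡ m)))

theorem1p17 : lhs ≈ₚ rhs
theorem1p17 N = trans (agree (lhs-Φ N) N ℕₚ.≤-refl) (sym (rhs-Φ N))
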